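{- Let $G$ be a 2-connected graph with $n$ vertices. Then $$Kf(G) \leq \frac{n^3-n}{12},$$ with equality if and only if $G = C_n$, the cycle on $n$ vertices.
   Context: All graphs are finite, simple and undirected. For a connected graph $G$ and vertices $u,v$, the resistance distance $\Omega_G(u,v)$ is the effective resistance between $u$ and $v$ in the electrical network obtained from $G$ by replacing each edge with a unit resistor. The Kirchhoff index is $Kf(G)=\sum_{\{u,v\}\subseteq V(G)}\Omega_G(u,v)$, the sum over unordered pairs of distinct vertices. A graph is 2-connected if it is connected, has at least three vertices, and has no cut vertex. -}

module Defs where

open import Data.Nat as ℕ using (ℕ; zero; suc; _∸_; _^_)
open import Data.Bool using (Bool; true; false; if_then_else_; _∧_; _∨_)
open import Data.Fin using (Fin; toℕ)
import Data.Fin as F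
open import Data.Fin.Permutation using (Permutation′; _⟨$⟩ʳ_)
open import Data.Integer using (+_)
open import Data.Rational using (ℚ; 0ℚ; 1ℚ; _+_; _-_; _/_)
open import Data.Product using (Σ; _×_)
open import Data.Unit using (⊤)
open import Relation.Binary.PropositionalEquality using (_≡_; _≢_)
open import Relation.Nullary using (Dec; does)
open import Data.Fin using (_≟_)

record Graph (n : ℕ) : Set where
  field
    adj   : Fin n → Fin n → Bool
    sym   : ∀ i j → adj i j ≡ adj j i
    irrefl : ∀ i → adj i i ≡ false
open Graph public

data Reach {n : ℕ} (G : Graph n) (P : Fin n → Set) : Fin n → Fin n → Set where
  here : ∀ {u} → P u → Reach G P u u
  step : ∀ {u x w} → P u → adj G u x ≡ true → Reach G P x w → Reach G P u w

Connected : ∀ {n} → Graph n → Set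
Connected G = ∀ u w → Reach G (λ _ → ⊤) u w

TwoConnected : ∀ {n} → Graph n → Set
TwoConnected {n} G =
  (3 ℕ.≤ n) × Connected G ×
  (∀ v u w → u ≢ v → w ≢ v → Reach G (λ x → x ≢ v) u w)

sumFin : ∀ n → (Fin n → ℚ) → ℚ
sumFin zero f = 0ℚ
sumFin (suc n) f = f F.zero + sumFin n (λ i → f (F.suc i))

δ : ∀ {n} → Fin n → Fin n → ℚ
δ a b = if does (a ≟ b) then 1ℚ else 0ℚ

-- Effective resistance between u and v in the unit-resistor network of G:
-- a potential φ realising a unit current injected at u and extracted at v
-- (Ohm's law on each unit edge + Kirchhoff's current law at each vertex),
-- and r is the resulting potential difference φ(u) - φ(v).
IsResistance : ∀ {n} → Graph n → Fin n → Fin n → ℚ → Set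
IsResistance {n} G u v r =
  Σ (Fin n → ℚ) λ φ →
    (∀ w → sumFin n (λ x → if adj G w x then φ w - φ x else 0ℚ) ≡ δ w u - δ w v)
    × (r ≡ φ u - φ v)

Kf : ∀ {n} → (Fin n → Fin n → ℚ) → ℚ
Kf {n} R = sumFin n λ u → sumFin n λ v →
  if toℕ u ℕ.<ᵇ toℕ v then R u v else 0ℚ

cycleAdj : (n : ℕ) → Fin n → Fin n → Bool
cycleAdj n i j =
  let a = toℕ i ; b = toℕ j in
  (b ℕ.≡ᵇ suc a) ∨ (a ℕ.≡ᵇ suc b) ∨
  ((a ℕ.≡ᵇ (n ∸ 1)) ∧ (b ℕ.≡ᵇ 0)) ∨ ((b ℕ.≡ᵇ (n ∸ 1)) ∧ (a ℕ.≡ᵇ 0))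

IsoToCycle : ∀ {n} → Graph n → Set
IsoToCycle {n} G =
  Σ (Permutation′ n) λ π → ∀ i j → adj G (π ⟨$⟩ʳ i) (π ⟨$⟩ʳ j) ≡ cycleAdj n i j

bound : ℕ → ℚ
bound n = (+ (n ^ 3 ∸ n)) / 12

{-# OPTIONS --safe #-}
module Submission where

-- Fix a vertex s and a neighbour t of it.  A 2-connected graph has an st-numbering: s comes first,
-- t comes last, and every other vertex has both an earlier and a later neighbour.  (Start from the
-- edge st and keep inserting ears right after the earlier of their two ends.)
--
-- Let v have position k, counted from 0.  Going down from v to s takes at most k edges; going up
-- from v to t and then along ts takes at most n - k edges; the two routes are edge-disjoint.  Sending
-- the fractions α = (n - k)/n and β = k/n of a unit current along them and comparing with the energy
-- of the true current gives R(s,v) ≤ α²k + β²(n - k) = k(n - k)/n.  Summing over k, every row sum of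
-- the resistance matrix is at most (n² - 1)/6, which is the bound.
--
-- If a neighbour of v below it is not the immediate predecessor, the descending route can be
-- shortened and the inequality is strict.  So equality forces consecutive vertices to be the only
-- edges besides st, which is a cycle.  Conversely, the resistances of the cycle are read off an explicit
-- potential: any potential will do, because resistances are unique by reciprocity.

open import Defs
open import Algebra.Properties.CommutativeMonoid.Sum using () renaming (sum to monoidSum; sum-permute to monoidSum-permute)
open import Data.Bool using (true; false; if_then_else_)
open import Data.Empty using (⊥-elim)
open import Data.Fin as F using (Fin; toℕ; _≟_)
open import Data.Fin.Permutation using (Permutation′; permutation; flip; _⟨$⟩ʳ_; _⟨$⟩ˡ_; inverseˡ; inverseʳ)
open import Data.Fin.Properties using (toℕ-injective; toℕ<n; toℕ-cast; toℕ-fromℕ; toℕ-fromℕ<; cast-involutive; injective⇒≤; all?; ¬∀⟶∃¬)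
open import Data.Integer as ℤ using () renaming (+_ to pos)
import Data.Integer.Tactic.RingSolver as ℤRing
open import Data.List.Base using (List; []; _∷_; _++_; [_]; length; lookup; reverse)
open import Data.List.Membership.DecPropositional using () renaming (_∈?_ to member?)
open import Data.List.Membership.Propositional using (_∈_; _∉_)
open import Data.List.Membership.Propositional.Properties using (∈-++⁻; ∈-lookup)
open import Data.List.Membership.Setoid.Properties using (index-injective)
open import Data.List.Properties using (length-++; unfold-reverse; reverse-++; length-reverse)
open import Data.List.Relation.Binary.Permutation.Propositional using (_↭_; ↭-sym; ↭-trans; prep; ↭⇒↭ₛ)
import Data.List.Relation.Binary.Permutation.Propositional.Properties as Perm
import Data.List.Relation.Binary.Permutation.Setoid.Properties as PermSetoid
open import Data.List.Relation.Binary.Sublist.Propositional using (_⊆_; []; _∷_; _∷ʳ_; ⊆-refl; ⊆-trans; from∈; minimum; to∈)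
import Data.List.Relation.Binary.Sublist.Propositional as Sublist
import Data.List.Relation.Binary.Sublist.Propositional.Properties as Sublist
open import Data.List.Relation.Unary.All as All using ([]; _∷_)
open import Data.List.Relation.Unary.All.Properties using (¬Any⇒All¬; All¬⇒¬Any)
open import Data.List.Relation.Unary.AllPairs using ([]; _∷_)
open import Data.List.Relation.Unary.Any using (here; there; index)
open import Data.List.Relation.Unary.Any.Properties using (lookup-index; reverse⁻)
open import Data.List.Relation.Unary.Unique.Propositional using (Unique)
import Data.List.Relation.Unary.Unique.Propositional.Properties as Unique
open import Data.Nat as ℕ using (ℕ; zero; suc; s≤s; z≤n; ∣_-_∣)
open import Data.Nat.Induction using (<-wellFounded)
import Data.Nat.Properties as ℕ
open import Data.Product using (_×_; _,_; proj₁; proj₂; ∃; ∃₂)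
open import Data.Rational using (ℚ; 0ℚ; 1ℚ; ½; _≤_; _<_; _+_; _*_; _-_; -_; _/_; 1/_; Positive; positive; nonNegative; toℚᵘ)
import Data.Rational.Properties as ℚ
open import Data.Rational.Unnormalised as ℚᵘ using (mkℚᵘ; *≡*)
import Data.Rational.Unnormalised.Properties as ℚᵘ
open import Data.Sum using (_⊎_; inj₁; inj₂; [_,_]′)
open import Function using (_∘_; _$_; _⇔_; mk⇔)
open import Induction.WellFounded using (Acc; acc)
open import Level using (0ℓ)
open import Relation.Binary.Definitions using (tri<; tri≈; tri>)
open import Relation.Binary.PropositionalEquality using (_≡_; _≢_; refl; trans; cong; cong₂; subst; setoid; ≢-sym; module ≡-Reasoning) renaming (sym to ≡-sym)
open import Relation.Nullary using (Dec; yes; no; does; ¬_; contradiction; ¬?; _×-dec_; _⊎-dec_)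
open import Relation.Nullary.Decidable using (dec⇒maybe)
open import Tactic.RingSolver using (solve-∀)
open import Tactic.RingSolver.Core.AlmostCommutativeRing using (AlmostCommutativeRing; fromCommutativeRing)

ring : AlmostCommutativeRing 0ℓ 0ℓ
ring = fromCommutativeRing ℚ.+-*-commutativeRing (λ q → dec⇒maybe (0ℚ ℚ.≟ q))

-- Ordered arithmetic on ℚ

0≤q-p⇒p≤q : ∀ {p q} → 0ℚ ≤ q - p → p ≤ q
0≤q-p⇒p≤q {p} {q} h = ℚ.≤-trans (ℚ.≤-reflexive (≡-sym (ℚ.+-identityʳ p)))
  (ℚ.≤-trans (ℚ.+-monoʳ-≤ p h) (ℚ.≤-reflexive (cancel p q)))
  where
  cancel : ∀ p q → p + (q - p) ≡ q
  cancel = solve-∀ ring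

+-cancelˡ-≤ : ∀ p {q r} → p + q ≤ p + r → q ≤ r
+-cancelˡ-≤ p {q} {r} le with ℚ._≤?_ q r
... | yes q≤r = q≤r
... | no q≰r = ⊥-elim (ℚ.<-irrefl refl (ℚ.<-≤-trans (ℚ.+-monoʳ-< p (ℚ.≰⇒> q≰r)) le))

0≤p*q : ∀ {p q} → 0ℚ ≤ p → 0ℚ ≤ q → 0ℚ ≤ p * q
0≤p*q {p} {q} 0≤p 0≤q = subst (_≤ p * q) (ℚ.*-zeroʳ p)
  (ℚ.*-monoˡ-≤-nonNeg p ⦃ nonNegative 0≤p ⦄ 0≤q)

0≤p*p : ∀ p → 0ℚ ≤ p * p
0≤p*p p with ℚ.≤-total 0ℚ p
... | inj₁ 0≤p = 0≤p*q 0≤p 0≤p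
... | inj₂ p≤0 = subst (0ℚ ≤_) (square-neg p) (0≤p*q (ℚ.neg-antimono-≤ p≤0) (ℚ.neg-antimono-≤ p≤0))
  where
  square-neg : ∀ p → (- p) * (- p) ≡ p * p
  square-neg = solve-∀ ring

0≤1 : 0ℚ ≤ 1ℚ
0≤1 = 0≤p*p 1ℚ

double-injective : ∀ {p q} → p + p ≡ q + q → p ≡ q
double-injective {p} {q} eq with ℚ.<-cmp p q
... | tri< p<q _ _ = ⊥-elim (ℚ.<-irrefl eq (ℚ.+-mono-< p<q p<q))
... | tri≈ _ p≡q _ = p≡q
... | tri> _ _ q<p = ⊥-elim (ℚ.<-irrefl (≡-sym eq) (ℚ.+-mono-< q<p q<p))

double-cancel-≤ : ∀ {p q} → p + p ≤ q + q → p ≤ q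
double-cancel-≤ {p} {q} le with ℚ._≤?_ p q
... | yes p≤q = p≤q
... | no p≰q = ⊥-elim (ℚ.<-irrefl refl (ℚ.<-≤-trans (ℚ.+-mono-< q<p q<p) le))
  where q<p = ℚ.≰⇒> p≰q

-- Recursion makes `ι (suc k)` unfold to `1ℚ + ι k`. Ring identities can then be proved over plain
-- variables, with numerals such as `ι 3` written out as iterated `1ℚ +`, and still match by
-- computation.
ι : ℕ → ℚ
ι zero = 0ℚ
ι (suc k) = 1ℚ + ι k

0≤ι : ∀ k → 0ℚ ≤ ι k
0≤ι zero = ℚ.≤-refl
0≤ι (suc k) = ℚ.+-mono-≤ 0≤1 (0≤ι k)

ι-+ : ∀ a b → ι (a ℕ.+ b) ≡ ι a + ι b
ι-+ zero b = ≡-sym (ℚ.+-identityˡ (ι b))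
ι-+ (suc a) b = trans (cong (1ℚ +_) (ι-+ a b)) (≡-sym (ℚ.+-assoc 1ℚ (ι a) (ι b)))

ι-* : ∀ a b → ι (a ℕ.* b) ≡ ι a * ι b
ι-* zero b = ≡-sym (ℚ.*-zeroˡ (ι b))
ι-* (suc a) b = trans (ι-+ b (a ℕ.* b)) (trans (cong (ι b +_) (ι-* a b)) (distrib (ι a) (ι b)))
  where
  distrib : ∀ a b → b + a * b ≡ (1ℚ + a) * b
  distrib = solve-∀ ring

ι-∸ : ∀ {a b} → b ℕ.≤ a → ι (a ℕ.∸ b) ≡ ι a - ι b
ι-∸ {a} {b} b≤a = trans (shuffle (ι (a ℕ.∸ b)) (ι b))
  (cong (_- ι b) (trans (≡-sym (ι-+ (a ℕ.∸ b) b)) (cong ι (ℕ.m∸n+n≡m b≤a))))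
  where
  shuffle : ∀ d b → d ≡ (d + b) - b
  shuffle = solve-∀ ring

ι-mono-≤ : ∀ {a b} → a ℕ.≤ b → ι a ≤ ι b
ι-mono-≤ {a} {b} a≤b = 0≤q-p⇒p≤q (subst (0ℚ ≤_) (ι-∸ a≤b) (0≤ι (b ℕ.∸ a)))

ι-mono-< : ∀ {a b} → a ℕ.< b → ι a < ι b
ι-mono-< {a} a<b = ℚ.<-≤-trans (subst (_< 1ℚ + ι a) (ℚ.+-identityˡ (ι a)) (ℚ.+-monoˡ-< (ι a) (ℚ.positive⁻¹ 1ℚ)))
  (ι-mono-≤ a<b)

-- Sums and indicators

if-yes : ∀ {P : Set} (d : Dec P) {a b : ℚ} → P → (if does d then a else b) ≡ a
if-yes (yes _) _ = refl
if-yes (no ¬p) p = contradiction p ¬p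

if-no : ∀ {P : Set} (d : Dec P) {a b : ℚ} → ¬ P → (if does d then a else b) ≡ b
if-no (yes p) ¬p = contradiction p ¬p
if-no (no _) _ = refl

if-cong : ∀ {P : Set} (d : Dec P) {a b c : ℚ} → (P → a ≡ b) → (if does d then a else c) ≡ (if does d then b else c)
if-cong (yes p) eq = eq p
if-cong (no _) _ = refl

0≤if : ∀ {P : Set} (d : Dec P) {a : ℚ} → 0ℚ ≤ a → 0ℚ ≤ (if does d then a else 0ℚ)
0≤if (yes _) 0≤a = 0≤a
0≤if (no _) _ = ℚ.≤-refl

sum-cong : ∀ {n} {f g : Fin n → ℚ} → (∀ i → f i ≡ g i) → sumFin n f ≡ sumFin n g
sum-cong {zero} f≡g = refl
sum-cong {suc n} f≡g = cong₂ _+_ (f≡g F.zero) (sum-cong (f≡g ∘ F.suc))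

sum-mono : ∀ {n} {f g : Fin n → ℚ} → (∀ i → f i ≤ g i) → sumFin n f ≤ sumFin n g
sum-mono {zero} f≤g = ℚ.≤-refl
sum-mono {suc n} f≤g = ℚ.+-mono-≤ (f≤g F.zero) (sum-mono (f≤g ∘ F.suc))

sum-mono-< : ∀ {n} {f g : Fin n → ℚ} → (∀ i → f i ≤ g i) → ∀ k → f k < g k → sumFin n f < sumFin n g
sum-mono-< f≤g F.zero fk<gk = ℚ.+-mono-<-≤ fk<gk (sum-mono (f≤g ∘ F.suc))
sum-mono-< f≤g (F.suc k) fk<gk = ℚ.+-mono-≤-< (f≤g F.zero) (sum-mono-< (f≤g ∘ F.suc) k fk<gk)

sum-zero : ∀ n → sumFin n (λ _ → 0ℚ) ≡ 0ℚ
sum-zero zero = refl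
sum-zero (suc n) = trans (ℚ.+-identityˡ _) (sum-zero n)

0≤sum : ∀ {n} {f : Fin n → ℚ} → (∀ i → 0ℚ ≤ f i) → 0ℚ ≤ sumFin n f
0≤sum {n} {f} 0≤f = subst (_≤ sumFin n f) (sum-zero n) (sum-mono 0≤f)

sum-+ : ∀ {n} (f g : Fin n → ℚ) → sumFin n (λ i → f i + g i) ≡ sumFin n f + sumFin n g
sum-+ {zero} f g = refl
sum-+ {suc n} f g = trans (cong (f F.zero + g F.zero +_) (sum-+ (f ∘ F.suc) (g ∘ F.suc)))
  (interchange (f F.zero) (g F.zero) _ _)
  where
  interchange : ∀ a b c d → a + b + (c + d) ≡ a + c + (b + d)
  interchange = solve-∀ ring

sum-* : ∀ {n} c (f : Fin n → ℚ) → sumFin n (λ i → c * f i) ≡ c * sumFin n f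
sum-* {zero} c f = ≡-sym (ℚ.*-zeroʳ c)
sum-* {suc n} c f = trans (cong (c * f F.zero +_) (sum-* c (f ∘ F.suc))) (≡-sym (ℚ.*-distribˡ-+ c _ _))

sum-const : ∀ n c → sumFin n (λ _ → c) ≡ ι n * c
sum-const zero c = ≡-sym (ℚ.*-zeroˡ c)
sum-const (suc n) c = trans (cong (c +_) (sum-const n c)) (distrib c (ι n))
  where
  distrib : ∀ c m → c + m * c ≡ (1ℚ + m) * c
  distrib = solve-∀ ring

sum-swap : ∀ {m n} (f : Fin m → Fin n → ℚ) →
  sumFin m (λ i → sumFin n (f i)) ≡ sumFin n (λ j → sumFin m (λ i → f i j))
sum-swap {zero} {n} f = ≡-sym (sum-zero n)
sum-swap {suc m} f = trans (cong (sumFin _ (f F.zero) +_) (sum-swap (f ∘ F.suc))) (≡-sym (sum-+ (f F.zero) _))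

δ-refl : ∀ {n} (k : Fin n) → δ k k ≡ 1ℚ
δ-refl k = if-yes (k ≟ k) refl

δ-≢ : ∀ {n} {j k : Fin n} → j ≢ k → δ j k ≡ 0ℚ
δ-≢ {j = j} {k} = if-no (j ≟ k)

sum-δ : ∀ {n} (f : Fin n → ℚ) k → sumFin n (λ i → f i * δ i k) ≡ f k
sum-δ {suc n} f F.zero = trans (cong₂ _+_ (ℚ.*-identityʳ (f F.zero))
    (trans (sum-cong (λ i → ℚ.*-zeroʳ (f (F.suc i)))) (sum-zero n))) (ℚ.+-identityʳ _)
sum-δ {suc n} f (F.suc k) = trans (cong₂ _+_ (ℚ.*-zeroʳ (f F.zero))
    (sum-δ (f ∘ F.suc) k)) (ℚ.+-identityˡ _)

sum-permute : ∀ {n} (f : Fin n → ℚ) (π : Permutation′ n) → sumFin n (λ i → f (π ⟨$⟩ʳ i)) ≡ sumFin n f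
sum-permute f π = trans (sumFin≡sum (λ i → f (π ⟨$⟩ʳ i)))
  (trans (≡-sym (monoidSum-permute ℚ.+-0-commutativeMonoid f π)) (≡-sym (sumFin≡sum f)))
  where
  sumFin≡sum : ∀ {n} (f : Fin n → ℚ) → sumFin n f ≡ monoidSum ℚ.+-0-commutativeMonoid f
  sumFin≡sum {zero} f = refl
  sumFin≡sum {suc n} f = cong (f F.zero +_) (sumFin≡sum (f ∘ F.suc))

sum-telescope : ∀ n (F : ℕ → ℚ) → sumFin n (λ i → F (suc (toℕ i)) - F (toℕ i)) ≡ F n - F 0
sum-telescope zero F = ≡-sym (ℚ.+-inverseʳ (F 0))
sum-telescope (suc n) F = trans (cong (F 1 - F 0 +_) (sum-telescope n (F ∘ suc))) (shuffle (F 1) (F 0) (F (suc n)))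
  where
  shuffle : ∀ a b c → a - b + (c - a) ≡ c - b
  shuffle = solve-∀ ring

module _ {n} (rank : Fin n → ℕ) where

  -- The rank stays a parameter: `toℕ` serves for reciprocity and for the Kirchhoff index, while the
  -- energy estimate orients each edge upwards along an st-numbering.
  sum< : (Fin n → Fin n → ℚ) → ℚ
  sum< F = sumFin n λ w → sumFin n λ x → if does (rank w ℕ.<? rank x) then F w x else 0ℚ

  sum<-cong : ∀ {F F′ : Fin n → Fin n → ℚ} → (∀ w x → rank w ℕ.< rank x → F w x ≡ F′ w x) →
    sum< F ≡ sum< F′
  sum<-cong eq = sum-cong λ w → sum-cong λ x → if-cong (rank w ℕ.<? rank x) (eq w x)

  -- By injectivity of the rank, every off-diagonal pair lies in exactly one of `below` and `above`;
  -- exchanging the two summations of `above` makes it range over the same pairs as `below`.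
  sum-by-pairs : (∀ {w x} → rank w ≡ rank x → w ≡ x) → (F : Fin n → Fin n → ℚ) → (∀ w → F w w ≡ 0ℚ) →
    sumFin n (λ w → sumFin n (F w)) ≡ sum< (λ w x → F w x + F x w)
  sum-by-pairs inj F diag = begin
    sumFin n (λ w → sumFin n (F w))
      ≡⟨ sum-cong (λ w → trans (sum-cong (split w)) (sum-+ (below w) (above w))) ⟩
    sumFin n (λ w → sumFin n (below w) + sumFin n (above w))
      ≡⟨ sum-+ (λ w → sumFin n (below w)) (λ w → sumFin n (above w)) ⟩
    sumFin n (λ w → sumFin n (below w)) + sumFin n (λ w → sumFin n (above w))
      ≡⟨ cong (sumFin n (λ w → sumFin n (below w)) +_) (sum-swap above) ⟩
    sumFin n (λ w → sumFin n (below w)) + sumFin n (λ x → sumFin n (λ w → above w x))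
      ≡⟨ sum-+ (λ w → sumFin n (below w)) (λ x → sumFin n (λ w → above w x)) ⟨
    sumFin n (λ w → sumFin n (below w) + sumFin n (λ x → above x w))
      ≡⟨ sum-cong (λ w → trans (≡-sym (sum-+ (below w) (λ x → above x w))) (sum-cong (merge w))) ⟩
    sum< (λ w x → F w x + F x w) ∎
    where
    open ≡-Reasoning
    below above : Fin n → Fin n → ℚ
    below w x = if does (rank w ℕ.<? rank x) then F w x else 0ℚ
    above w x = if does (rank x ℕ.<? rank w) then F w x else 0ℚ
    split : ∀ w x → F w x ≡ below w x + above w x
    split w x with ℕ.<-cmp (rank w) (rank x)
    ... | tri< w<x _ x≮w = ≡-sym (trans (cong₂ _+_ (if-yes (rank w ℕ.<? rank x) w<x)
      (if-no (rank x ℕ.<? rank w) x≮w)) (ℚ.+-identityʳ _))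
    ... | tri> w≮x _ x<w = ≡-sym (trans (cong₂ _+_ (if-no (rank w ℕ.<? rank x) w≮x)
      (if-yes (rank x ℕ.<? rank w) x<w)) (ℚ.+-identityˡ _))
    ... | tri≈ w≮x eq x≮w = trans (subst (λ y → F w y ≡ 0ℚ) (inj eq) (diag w))
      (≡-sym (cong₂ _+_ (if-no (rank w ℕ.<? rank x) w≮x) (if-no (rank x ℕ.<? rank w) x≮w)))
    merge : ∀ w x → below w x + above x w ≡ (if does (rank w ℕ.<? rank x) then F w x + F x w else 0ℚ)
    merge w x with does (rank w ℕ.<? rank x)
    ... | true = refl
    ... | false = refl

-- The Laplacian

module _ {n} (G : Graph n) where

  laplacian : (Fin n → ℚ) → Fin n → ℚ
  laplacian φ w = sumFin n (λ x → if adj G w x then φ w - φ x else 0ℚ)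

  -- Summation by parts: the two orientations of an edge contribute `ψ w * (φ w - φ x)` and
  -- `ψ x * (φ x - φ w)`, and their sum factors.
  green : (rank : Fin n → ℕ) → (∀ {w x} → rank w ≡ rank x → w ≡ x) → (ψ φ : Fin n → ℚ) →
    sumFin n (λ w → ψ w * laplacian φ w) ≡
    sum< rank (λ w x → if adj G w x then (ψ w - ψ x) * (φ w - φ x) else 0ℚ)
  green rank inj ψ φ = begin
    sumFin n (λ w → ψ w * laplacian φ w)
      ≡⟨ sum-cong (λ w → ≡-sym (sum-* (ψ w) (λ x → if adj G w x then φ w - φ x else 0ℚ))) ⟩
    sumFin n (λ w → sumFin n (flow w))
      ≡⟨ sum-by-pairs rank inj flow (λ w → diag w) ⟩
    sum< rank (λ w x → flow w x + flow x w)
      ≡⟨ sum<-cong rank (λ w x _ → pair w x) ⟩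
    sum< rank (λ w x → if adj G w x then (ψ w - ψ x) * (φ w - φ x) else 0ℚ) ∎
    where
    open ≡-Reasoning
    flow : Fin n → Fin n → ℚ
    flow w x = ψ w * (if adj G w x then φ w - φ x else 0ℚ)
    diag : ∀ w → flow w w ≡ 0ℚ
    diag w rewrite irrefl G w = ℚ.*-zeroʳ (ψ w)
    arith : ∀ a b c d → a * (c - d) + b * (d - c) ≡ (a - b) * (c - d)
    arith = solve-∀ ring
    pair : ∀ w x → flow w x + flow x w ≡ (if adj G w x then (ψ w - ψ x) * (φ w - φ x) else 0ℚ)
    pair w x rewrite sym G x w with adj G w x
    ... | true = arith (ψ w) (ψ x) (φ w) (φ x)
    ... | false = cong₂ _+_ (ℚ.*-zeroʳ (ψ w)) (ℚ.*-zeroʳ (ψ x))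

  test-dipole : ∀ {u v} ψ φ → (∀ w → laplacian φ w ≡ δ w u - δ w v) →
    sumFin n (λ w → ψ w * laplacian φ w) ≡ ψ u - ψ v
  test-dipole {u} {v} ψ φ eq = begin
    sumFin n (λ w → ψ w * laplacian φ w)
      ≡⟨ sum-cong (λ w → trans (cong (ψ w *_) (eq w)) (expand (ψ w) (δ w u) (δ w v))) ⟩
    sumFin n (λ w → ψ w * δ w u + - 1ℚ * (ψ w * δ w v))
      ≡⟨ sum-+ (λ w → ψ w * δ w u) (λ w → - 1ℚ * (ψ w * δ w v)) ⟩
    sumFin n (λ w → ψ w * δ w u) + sumFin n (λ w → - 1ℚ * (ψ w * δ w v))
      ≡⟨ cong₂ _+_ (sum-δ ψ u) (trans (sum-* (- 1ℚ) (λ w → ψ w * δ w v)) (cong (- 1ℚ *_) (sum-δ ψ v))) ⟩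
    ψ u + - 1ℚ * ψ v
      ≡⟨ collect (ψ u) (ψ v) ⟩
    ψ u - ψ v ∎
    where
    open ≡-Reasoning
    expand : ∀ p a b → p * (a - b) ≡ p * a + - 1ℚ * (p * b)
    expand = solve-∀ ring
    collect : ∀ a b → a + - 1ℚ * b ≡ a - b
    collect = solve-∀ ring

  -- The edge sum in `green` is symmetric in `ψ` and `φ`, so testing either dipole equation against
  -- the other potential gives the same number.
  reciprocity : ∀ {a b c d} φ ψ → (∀ w → laplacian φ w ≡ δ w a - δ w b) →
    (∀ w → laplacian ψ w ≡ δ w c - δ w d) → ψ a - ψ b ≡ φ c - φ d
  reciprocity φ ψ eqφ eqψ = begin
    _ ≡⟨ test-dipole ψ φ eqφ ⟨
    _ ≡⟨ green toℕ toℕ-injective ψ φ ⟩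
    _ ≡⟨ sum<-cong toℕ (λ w x _ → exchange w x) ⟩
    _ ≡⟨ green toℕ toℕ-injective φ ψ ⟨
    _ ≡⟨ test-dipole φ ψ eqψ ⟩
    _ ∎
    where
    open ≡-Reasoning
    exchange : ∀ w x → (if adj G w x then (ψ w - ψ x) * (φ w - φ x) else 0ℚ) ≡
      (if adj G w x then (φ w - φ x) * (ψ w - ψ x) else 0ℚ)
    exchange w x with adj G w x
    ... | true = ℚ.*-comm (ψ w - ψ x) (φ w - φ x)
    ... | false = refl

  resistance-unique : ∀ {u v r r′} → IsResistance G u v r → IsResistance G u v r′ → r ≡ r′
  resistance-unique (φ , eqφ , refl) (ψ , eqψ , refl) = reciprocity ψ φ eqψ eqφ

  resistance-sym : ∀ {u v r r′} → IsResistance G u v r → IsResistance G v u r′ → r ≡ r′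
  resistance-sym {u} {v} (φ , eqφ , refl) (ψ , eqψ , refl) = trans (swap-negate (φ u) (φ v))
    (trans (cong -_ (reciprocity ψ φ eqψ eqφ)) (negate-swap (ψ u) (ψ v)))
    where
    swap-negate : ∀ a b → a - b ≡ - (b - a)
    swap-negate = solve-∀ ring
    negate-swap : ∀ a b → - (a - b) ≡ b - a
    negate-swap = solve-∀ ring

  -- The case `ψ = φ` of `green`: the energy dissipated by a unit current is the potential
  -- difference that drives it.
  energy-identity : (rank : Fin n → ℕ) → (∀ {w x} → rank w ≡ rank x → w ≡ x) → ∀ {u v} φ →
    (∀ w → laplacian φ w ≡ δ w u - δ w v) →
    sum< rank (λ w x → if adj G w x then (φ w - φ x) * (φ w - φ x) else 0ℚ) ≡ φ u - φ v
  energy-identity rank inj φ eq = trans (≡-sym (green rank inj φ φ)) (test-dipole φ φ eq)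

-- Two edge-disjoint descents

sq : ∀ {n} → (Fin n → ℚ) → Fin n → Fin n → ℚ
sq f w x = (f w - f x) * (f w - f x)

sq-sym : ∀ {n} (f : Fin n → ℚ) w x → sq f w x ≡ sq f x w
sq-sym f w x = exchange (f w) (f x)
  where
  exchange : ∀ a b → (a - b) * (a - b) ≡ (b - a) * (b - a)
  exchange = solve-∀ ring

-- Iterating `parent` leads from any vertex to the root `r`. One instance goes down to `s` along
-- `lower`, measured by rank; the other goes up to `t` along `higher`, measured by height.
module Descent {n} (ρ : Fin n → ℕ) (r : Fin n) (parent : Fin n → Fin n)
  (descends : ∀ {x} → x ≢ r → ρ (parent x) ℕ.< ρ x) (f : Fin n → ℚ) (α : ℚ) where

  below? : ∀ k x → Dec (x ≢ r × ρ x ℕ.≤ ρ k)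
  below? k x = ¬? (x ≟ r) ×-dec (ρ x ℕ.≤? ρ k)

  -- This counts the parent edges of all non-root vertices up to the level of `k`, not only those on
  -- the route from `k`. The surplus is harmless in an upper bound, no route has to be recorded, and
  -- disjointness can be read off from ranks.
  treeEnergy : Fin n → ℚ
  treeEnergy k = sumFin n λ x → if does (below? k x) then sq f (parent x) x else 0ℚ

  private
    twice : Fin n → Fin n → ℚ
    twice a b = α * (f a - f b) + α * (f a - f b)

    -- The edge from `k` to its parent is not yet counted at `parent k`, whose level is strictly
    -- smaller. Written as a sum against `δ`, it can be compared term by term.
    treeEnergy-step : ∀ {k} → k ≢ r → treeEnergy (parent k) + sq f (parent k) k ≤ treeEnergy k
    treeEnergy-step {k} k≢r = begin
      treeEnergy (parent k) + sq f (parent k) k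
        ≡⟨ cong (treeEnergy (parent k) +_) (sum-δ e k) ⟨
      treeEnergy (parent k) + sumFin n (λ x → e x * δ x k)
        ≡⟨ sum-+ (λ x → if does (below? (parent k) x) then e x else 0ℚ) (λ x → e x * δ x k) ⟨
      sumFin n (λ x → (if does (below? (parent k) x) then e x else 0ℚ) + e x * δ x k)
        ≤⟨ sum-mono pointwise ⟩
      treeEnergy k ∎
      where
      open ℚ.≤-Reasoning
      e : Fin n → ℚ
      e x = sq f (parent x) x
      pointwise : ∀ x → (if does (below? (parent k) x) then e x else 0ℚ) + e x * δ x k ≤
        (if does (below? k x) then e x else 0ℚ)
      pointwise x = lemma (below? (parent k) x) (x ≟ k) (below? k x)
        where
        -- The decisions become arguments, so that matching on them reduces all three conditionals,
        -- including the one inside `δ x k`.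
        lemma : (a : Dec (x ≢ r × ρ x ℕ.≤ ρ (parent k))) (b : Dec (x ≡ k)) (c : Dec (x ≢ r × ρ x ℕ.≤ ρ k)) →
          (if does a then e x else 0ℚ) + e x * (if does b then 1ℚ else 0ℚ) ≤ (if does c then e x else 0ℚ)
        lemma (yes (_ , le)) (yes refl) _ = ⊥-elim (ℕ.<-irrefl refl (ℕ.<-≤-trans (descends k≢r) le))
        lemma (yes (x≢r , le)) (no _) (yes _) = ℚ.≤-reflexive
          (trans (cong (e x +_) (ℚ.*-zeroʳ (e x))) (ℚ.+-identityʳ (e x)))
        lemma (yes (x≢r , le)) (no _) (no ¬c) = ⊥-elim (¬c (x≢r , ℕ.≤-trans le (ℕ.<⇒≤ (descends k≢r))))
        lemma (no _) (yes refl) (yes _) = ℚ.≤-reflexive (trans (ℚ.+-identityˡ _) (ℚ.*-identityʳ (e x)))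
        lemma (no _) (yes refl) (no ¬c) = ⊥-elim (¬c (k≢r , ℕ.≤-refl))
        lemma (no _) (no _) c = subst (_≤ (if does c then e x else 0ℚ))
          (≡-sym (trans (ℚ.+-identityˡ _) (ℚ.*-zeroʳ (e x)))) (0≤if c (0≤p*p (f (parent x) - f x)))

    -- 2αd ≤ α² + d² on the edge from k to its parent
    descend-step : ∀ {k} → k ≢ r →
      twice r (parent k) ≤ α * α * ι (ρ (parent k)) + treeEnergy (parent k) →
      twice r k ≤ α * α * ι (suc (ρ (parent k))) + treeEnergy k
    descend-step {k} k≢r ih = begin
      twice r k
        ≡⟨ split α (f r) (f (parent k)) (f k) ⟩
      twice r (parent k) + twice (parent k) k
        ≤⟨ ℚ.+-mono-≤ ih (0≤q-p⇒p≤q {twice (parent k) k}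
          (subst (0ℚ ≤_) (square α (f (parent k) - f k)) (0≤p*p (α - (f (parent k) - f k))))) ⟩
      (α * α * ι (ρ (parent k)) + treeEnergy (parent k)) + (α * α + sq f (parent k) k)
        ≡⟨ regroup (α * α) (ι (ρ (parent k))) (treeEnergy (parent k)) (sq f (parent k) k) ⟩
      α * α * ι (suc (ρ (parent k))) + (treeEnergy (parent k) + sq f (parent k) k)
        ≤⟨ ℚ.+-monoʳ-≤ (α * α * ι (suc (ρ (parent k)))) (treeEnergy-step k≢r) ⟩
      α * α * ι (suc (ρ (parent k))) + treeEnergy k ∎
      where
      open ℚ.≤-Reasoning
      split : ∀ α a b c → α * (a - c) + α * (a - c) ≡ (α * (a - b) + α * (a - b)) + (α * (b - c) + α * (b - c))
      split = solve-∀ ring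
      square : ∀ α d → (α - d) * (α - d) ≡ (α * α + d * d) - (α * d + α * d)
      square = solve-∀ ring
      regroup : ∀ a m t s → (a * m + t) + (a + s) ≡ a * (1ℚ + m) + (t + s)
      regroup = solve-∀ ring

    descend-acc : ∀ k → Acc ℕ._<_ (ρ k) → twice r k ≤ α * α * ι (ρ k) + treeEnergy k
    descend-acc k (acc rec) with k ≟ r
    ... | yes refl = subst (_≤ α * α * ι (ρ k) + treeEnergy k) (≡-sym (vanish α (f k)))
      (ℚ.+-mono-≤ (0≤p*q (0≤p*p α) (0≤ι (ρ k))) (0≤sum λ x → 0≤if (below? k x) (0≤p*p (f (parent x) - f x))))
      where
      vanish : ∀ α a → α * (a - a) + α * (a - a) ≡ 0ℚ
      vanish = solve-∀ ring
    ... | no k≢r = ℚ.≤-trans (descend-step k≢r (descend-acc (parent k) (rec (descends k≢r))))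
      (ℚ.+-monoˡ-≤ (treeEnergy k) (ℚ.*-monoˡ-≤-nonNeg (α * α) ⦃ nonNegative (0≤p*p α) ⦄ (ι-mono-≤ (descends k≢r))))

  descend : ∀ k → twice r k ≤ α * α * ι (ρ k) + treeEnergy k
  descend k = descend-acc k (<-wellFounded (ρ k))

  -- Keeping the length `suc (ρ (parent k))` instead of rounding it up to `ρ k` preserves the saving
  -- when `parent k` skips a level; strictness in the theorem comes from here.
  descend-via-parent : ∀ {k} → k ≢ r → twice r k ≤ α * α * ι (suc (ρ (parent k))) + treeEnergy k
  descend-via-parent {k} k≢r = descend-step k≢r (descend (parent k))

if-×-dec : ∀ {P Q : Set} (d : Dec P) (e : Dec Q) q →
  (if does d then q else 0ℚ) * (if does e then 1ℚ else 0ℚ) ≡ (if does (d ×-dec e) then q else 0ℚ)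
if-×-dec (yes _) (yes _) q = ℚ.*-identityʳ q
if-×-dec (yes _) (no _) q = ℚ.*-zeroʳ q
if-×-dec (no _) (yes _) q = ℚ.*-zeroˡ 1ℚ
if-×-dec (no _) (no _) q = ℚ.*-zeroˡ 0ℚ

-- Edge-disjointness at a single pair of vertices: `q` is the energy of the pair, `τ` its term in
-- the total energy, and at most one of the three families contains it.
sum-at-most-one : ∀ {A B C : Set} (a : Dec A) (b : Dec B) (c : Dec C) {q τ : ℚ} →
  (A → τ ≡ q) → (B → τ ≡ q) → (C → τ ≡ q) → 0ℚ ≤ τ →
  ¬ (A × B) → ¬ (A × C) → ¬ (B × C) →
  (if does a then q else 0ℚ) + (if does b then q else 0ℚ) + (if does c then q else 0ℚ) ≤ τ
sum-at-most-one (yes a) (yes b) _ _ _ _ _ ¬ab _ _ = contradiction (a , b) ¬ab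
sum-at-most-one (yes a) (no _) (yes c) _ _ _ _ _ ¬ac _ = contradiction (a , c) ¬ac
sum-at-most-one (no _) (yes b) (yes c) _ _ _ _ _ _ ¬bc = contradiction (b , c) ¬bc
sum-at-most-one (yes a) (no _) (no _) {q} eq _ _ _ _ _ _ =
  ℚ.≤-reflexive (trans (trans (ℚ.+-identityʳ _) (ℚ.+-identityʳ q)) (≡-sym (eq a)))
sum-at-most-one (no _) (yes b) (no _) {q} _ eq _ _ _ _ _ =
  ℚ.≤-reflexive (trans (trans (ℚ.+-identityʳ _) (ℚ.+-identityˡ q)) (≡-sym (eq b)))
sum-at-most-one (no _) (no _) (yes c) {q} _ _ eq _ _ _ _ = ℚ.≤-reflexive (trans (ℚ.+-identityˡ q) (≡-sym (eq c)))
sum-at-most-one (no _) (no _) (no _) _ _ _ 0≤τ _ _ _ = 0≤τ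

-- st-numberings and the estimate for one resistance

module _ {n} (G : Graph n) (s t : Fin n) (position : Permutation′ n) where

  rank : Fin n → ℕ
  rank v = toℕ (position ⟨$⟩ʳ v)

  -- The edge st is reserved for the route to s around the top, so it does not count as a way down from t.
  IsLower IsHigher : Fin n → Fin n → Set
  IsLower w x = adj G w x ≡ true × rank w ℕ.< rank x × ¬ (w ≡ s × x ≡ t)
  IsHigher w x = adj G x w ≡ true × rank x ℕ.< rank w

-- Neighbours are stored as functions because they serve as parent maps; the values of `lower` at
-- `s` and of `higher` at `t` are arbitrary. Ranks come from a permutation, so that row sums can be
-- reindexed by rank.
record STNumbering {n} (G : Graph n) (s t : Fin n) : Set where
  field
    position : Permutation′ n
    s~t : adj G s t ≡ true
    rank-s : rank G s t position s ≡ 0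
    rank-t : suc (rank G s t position t) ≡ n
    lower higher : Fin n → Fin n
    lower-is-lower : ∀ {x} → x ≢ s → IsLower G s t position (lower x) x
    higher-is-higher : ∀ {x} → x ≢ t → IsHigher G s t position (higher x) x

module _ {n} {G : Graph n} {s t : Fin n} (N : STNumbering G s t) where
  open STNumbering N
  private
    rk = rank G s t position

  rank-injective : ∀ {w x} → rk w ≡ rk x → w ≡ x
  rank-injective {w} {x} eq = trans (≡-sym (inverseˡ position))
    (trans (cong (position ⟨$⟩ˡ_) (toℕ-injective eq)) (inverseˡ position))

  rank>0 : ∀ {x} → x ≢ s → 0 ℕ.< rk x
  rank>0 x≢s = ℕ.n≢0⇒n>0 (λ eq → x≢s (rank-injective (trans eq (≡-sym rank-s))))

  rank<n : ∀ x → rk x ℕ.< n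
  rank<n x = toℕ<n (position ⟨$⟩ʳ x)

  rank≤rank-t : ∀ x → rk x ℕ.≤ rk t
  rank≤rank-t x = ℕ.s≤s⁻¹ (subst (rk x ℕ.<_) (≡-sym rank-t) (rank<n x))

  -- The level for climbing. Together with the edge `ts`, the route over the top has at most
  -- `suc (height v)` edges, which is `n - rk v`.
  height : Fin n → ℕ
  height x = rk t ℕ.∸ rk x

  module _ (φ : Fin n → ℚ) {v} (v≢s : v ≢ s) (eqφ : ∀ w → laplacian G φ w ≡ δ w s - δ w v)
    (α β : ℚ) (α+β≡1 : α + β ≡ 1ℚ) where

    private
      module Down = Descent rk s lower (λ x≢s → proj₁ (proj₂ (lower-is-lower x≢s))) φ α
      module Up = Descent height t higher
        (λ {x} x≢t → ℕ.∸-monoʳ-< (proj₂ (higher-is-higher x≢t)) (rank≤rank-t (higher x))) φ β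

      E = sum< rk (λ w x → if adj G w x then sq φ w x else 0ℚ)

      -- The edges (lower x , x) with x at or below v, the edges (x , higher x) with x at or above v,
      -- and the edge st are pairwise distinct.
      disjoint-edges : Down.treeEnergy v + Up.treeEnergy v + sq φ s t ≤ E
      disjoint-edges = begin
        Down.treeEnergy v + Up.treeEnergy v + sq φ s t
          ≡⟨ cong₂ _+_ (cong₂ _+_ down-double up-double) st-double ⟩
        (sumFin n λ w → sumFin n (D w)) + (sumFin n λ w → sumFin n (U w)) + (sumFin n λ w → sumFin n (Z w))
          ≡⟨ cong (_+ (sumFin n λ w → sumFin n (Z w))) (sum-+ (λ w → sumFin n (D w)) (λ w → sumFin n (U w))) ⟨
        (sumFin n λ w → sumFin n (D w) + sumFin n (U w)) + (sumFin n λ w → sumFin n (Z w))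
          ≡⟨ sum-+ (λ w → sumFin n (D w) + sumFin n (U w)) (λ w → sumFin n (Z w)) ⟨
        (sumFin n λ w → sumFin n (D w) + sumFin n (U w) + sumFin n (Z w))
          ≡⟨ sum-cong (λ w → cong (_+ sumFin n (Z w)) (sum-+ (D w) (U w))) ⟨
        (sumFin n λ w → sumFin n (λ x → D w x + U w x) + sumFin n (Z w))
          ≡⟨ sum-cong (λ w → sum-+ (λ x → D w x + U w x) (Z w)) ⟨
        (sumFin n λ w → sumFin n λ x → D w x + U w x + Z w x)
          ≤⟨ sum-mono (λ w → sum-mono (pointwise w)) ⟩
        E ∎
        where
        open ℚ.≤-Reasoning
        -- Each family is spread over ordered pairs with the lower-ranked end first, the shape in
        -- which `E` lists the edges.
        D? : ∀ w x → Dec ((x ≢ s × rk x ℕ.≤ rk v) × w ≡ lower x)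
        D? w x = Down.below? v x ×-dec (w ≟ lower x)
        U? : ∀ w x → Dec ((w ≢ t × height w ℕ.≤ height v) × x ≡ higher w)
        U? w x = Up.below? v w ×-dec (x ≟ higher w)
        Z? : ∀ w x → Dec (w ≡ s × x ≡ t)
        Z? w x = (w ≟ s) ×-dec (x ≟ t)
        D U Z : Fin n → Fin n → ℚ
        D w x = if does (D? w x) then sq φ w x else 0ℚ
        U w x = if does (U? w x) then sq φ w x else 0ℚ
        Z w x = if does (Z? w x) then sq φ w x else 0ℚ

        down-double : Down.treeEnergy v ≡ sumFin n λ w → sumFin n (D w)
        down-double = trans (sum-cong λ x → trans
          (≡-sym (sum-δ (λ w → if does (Down.below? v x) then sq φ w x else 0ℚ) (lower x)))
          (sum-cong λ w → if-×-dec (Down.below? v x) (w ≟ lower x) (sq φ w x))) (≡-sym (sum-swap D))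

        up-double : Up.treeEnergy v ≡ sumFin n λ w → sumFin n (U w)
        up-double = sum-cong λ w → trans (if-cong (Up.below? v w) (λ _ → sq-sym φ (higher w) w)) (trans
          (≡-sym (sum-δ (λ x → if does (Up.below? v w) then sq φ w x else 0ℚ) (higher w)))
          (sum-cong λ x → if-×-dec (Up.below? v w) (x ≟ higher w) (sq φ w x)))

        st-double : sq φ s t ≡ sumFin n λ w → sumFin n (Z w)
        st-double = trans (≡-sym (sum-δ (λ w → sq φ w t) s)) (sum-cong λ w →
          trans (at-s w) (trans (≡-sym (sum-δ (λ x → if does (w ≟ s) then sq φ w x else 0ℚ) t))
            (sum-cong λ x → if-×-dec (w ≟ s) (x ≟ t) (sq φ w x))))
          where
          at-s : ∀ w → sq φ w t * δ w s ≡ (if does (w ≟ s) then sq φ w t else 0ℚ)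
          at-s w with does (w ≟ s)
          ... | true = ℚ.*-identityʳ (sq φ w t)
          ... | false = ℚ.*-zeroʳ (sq φ w t)

        T : Fin n → Fin n → ℚ
        T w x = if does (rk w ℕ.<? rk x) then (if adj G w x then sq φ w x else 0ℚ) else 0ℚ

        T-edge : ∀ {w x} → adj G w x ≡ true → rk w ℕ.< rk x → T w x ≡ sq φ w x
        T-edge {w} {x} a lt = trans (if-yes (rk w ℕ.<? rk x) lt) (cong (if_then sq φ w x else 0ℚ) a)

        0≤T : ∀ w x → 0ℚ ≤ T w x
        0≤T w x = 0≤if (rk w ℕ.<? rk x) nonneg
          where
          nonneg : 0ℚ ≤ (if adj G w x then sq φ w x else 0ℚ)
          nonneg with adj G w x
          ... | true = 0≤p*p (φ w - φ x)
          ... | false = ℚ.≤-refl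

        height-reflects : ∀ {w} → height w ℕ.≤ height v → rk v ℕ.≤ rk w
        height-reflects {w} le = ℕ.≮⇒≥ λ w<v → ℕ.<-irrefl refl (ℕ.<-≤-trans (ℕ.∸-monoʳ-< w<v (rank≤rank-t v)) le)

        pointwise : ∀ w x → D w x + U w x + Z w x ≤ T w x
        pointwise w x = sum-at-most-one (D? w x) (U? w x) (Z? w x)
          (λ { ((x≢s , _) , refl) → T-edge (proj₁ (lower-is-lower x≢s)) (proj₁ (proj₂ (lower-is-lower x≢s))) })
          (λ { ((w≢t , _) , refl) → T-edge (proj₁ (higher-is-higher w≢t)) (proj₂ (higher-is-higher w≢t)) })
          (λ { (refl , refl) → T-edge s~t (subst (ℕ._< rk t) (≡-sym rank-s)
            (ℕ.<-≤-trans (rank>0 v≢s) (rank≤rank-t v))) })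
          (0≤T w x)
          -- A descending edge has its upper end at or below `v`, an ascending one its lower end at
          -- or above `v`. The edge `st` is barred from the descending family by `IsLower`, and from
          -- the ascending one because `s` ranks below `v`.
          (λ { (((x≢s , x≤v) , refl) , ((w≢t , hw) , eq)) → ℕ.<-irrefl refl
            (ℕ.<-≤-trans (proj₁ (proj₂ (lower-is-lower x≢s))) (ℕ.≤-trans x≤v (height-reflects hw))) })
          (λ { (((x≢s , _) , refl) , st) → proj₂ (proj₂ (lower-is-lower x≢s)) st })
          (λ { (((_ , hw) , _) , (refl , _)) → ℕ.<-irrefl refl
            (ℕ.<-≤-trans (rank>0 v≢s) (ℕ.≤-trans (height-reflects hw) (ℕ.≤-reflexive rank-s))) })

    -- Half of Thomson's principle by completing squares. Twice the resistance is split into the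
    -- shares of the two routes, and `2cd ≤ c² + d²` on each edge bounds it by the energy of the
    -- used edges plus the energy of the test flow. The former is at most the resistance itself,
    -- which cancels once.
    resistance-bound : φ s - φ v ≤ α * α * ι (suc (rk (lower v))) + β * β * (ι n - ι (rk v))
    resistance-bound = +-cancelˡ-≤ (φ s - φ v) $ begin
      (φ s - φ v) + (φ s - φ v)
        ≡⟨ unit (φ s - φ v) ⟩
      1ℚ * (φ s - φ v) + 1ℚ * (φ s - φ v)
        ≡⟨ cong (λ c → c * (φ s - φ v) + c * (φ s - φ v)) α+β≡1 ⟨
      (α + β) * (φ s - φ v) + (α + β) * (φ s - φ v)
        ≡⟨ split α β (φ s) (φ t) (φ v) ⟩
      (α * (φ s - φ v) + α * (φ s - φ v)) + (β * (φ t - φ v) + β * (φ t - φ v)) + (β * (φ s - φ t) + β * (φ s - φ t))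
        ≤⟨ ℚ.+-mono-≤ (ℚ.+-mono-≤ (Down.descend-via-parent v≢s) (Up.descend v))
            (0≤q-p⇒p≤q {β * (φ s - φ t) + β * (φ s - φ t)}
              (subst (0ℚ ≤_) (square β (φ s - φ t)) (0≤p*p (β - (φ s - φ t))))) ⟩
      (α * α * m + Down.treeEnergy v) + (β * β * ι (height v) + Up.treeEnergy v) + (β * β + sq φ s t)
        ≡⟨ regroup (α * α * m) (β * β) (ι (height v)) (Down.treeEnergy v) (Up.treeEnergy v) (sq φ s t) ⟩
      (Down.treeEnergy v + Up.treeEnergy v + sq φ s t) + (α * α * m + β * β * (1ℚ + ι (height v)))
        ≤⟨ ℚ.+-monoˡ-≤ (α * α * m + β * β * (1ℚ + ι (height v))) disjoint-edges ⟩
      E + (α * α * m + β * β * (1ℚ + ι (height v)))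
        ≡⟨ cong₂ (λ x y → x + (α * α * m + β * β * y)) (energy-identity G rk rank-injective φ eqφ) around ⟩
      (φ s - φ v) + (α * α * m + β * β * (ι n - ι (rk v))) ∎
      where
      open ℚ.≤-Reasoning
      m = ι (suc (rk (lower v)))
      unit : ∀ a → a + a ≡ 1ℚ * a + 1ℚ * a
      unit = solve-∀ ring
      split : ∀ α β s t v → (α + β) * (s - v) + (α + β) * (s - v) ≡
        (α * (s - v) + α * (s - v)) + (β * (t - v) + β * (t - v)) + (β * (s - t) + β * (s - t))
      split = solve-∀ ring
      square : ∀ α d → (α - d) * (α - d) ≡ (α * α + d * d) - (α * d + α * d)
      square = solve-∀ ring
      regroup : ∀ a b h x y z → (a + x) + (b * h + y) + (b + z) ≡ (x + y + z) + (a + b * (1ℚ + h))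
      regroup = solve-∀ ring
      around : 1ℚ + ι (height v) ≡ ι n - ι (rk v)
      around = trans (cong (1ℚ +_) (ι-∸ (rank≤rank-t v)))
        (trans (≡-sym (ℚ.+-assoc 1ℚ (ι (rk t)) (- ι (rk v)))) (cong (λ k → ι k - ι (rk v)) rank-t))

-- The bound as a polynomial in `n`

*-cancelˡ-pos : ∀ r → 0ℚ < r → ∀ {p q} → r * p ≡ r * q → p ≡ q
*-cancelˡ-pos r 0<r {p} {q} eq with ℚ.<-cmp p q
... | tri< p<q _ _ = ⊥-elim (ℚ.<-irrefl eq (ℚ.*-monoʳ-<-pos r ⦃ positive 0<r ⦄ p<q))
... | tri≈ _ p≡q _ = p≡q
... | tri> _ _ q<p = ⊥-elim (ℚ.<-irrefl (≡-sym eq) (ℚ.*-monoʳ-<-pos r ⦃ positive 0<r ⦄ q<p))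

six : ℚ
six = ι 6

0<six : 0ℚ < six
0<six = ι-mono-< {0} {6} (s≤s z≤n)

-- A quotient in `ℚ` is stored in lowest terms and does not compute for a variable numerator, so the
-- induction step is checked on unnormalised fractions by cross-multiplication.
/12≡ι* : ∀ m → (pos m) / 12 ≡ ι m * ((pos 1) / 12)
/12≡ι* zero = ≡-sym (ℚ.*-zeroˡ ((pos 1) / 12))
/12≡ι* (suc m) = begin
  (pos (suc m)) / 12
    ≡⟨ ℚ.toℚᵘ-injective unnormalised ⟩
  (pos 1) / 12 + (pos m) / 12
    ≡⟨ cong (((pos 1) / 12) +_) (/12≡ι* m) ⟩
  (pos 1) / 12 + ι m * ((pos 1) / 12)
    ≡⟨ distrib ((pos 1) / 12) (ι m) ⟩
  ι (suc m) * ((pos 1) / 12) ∎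
  where
  open ≡-Reasoning
  distrib : ∀ c m → c + m * c ≡ (1ℚ + m) * c
  distrib = solve-∀ ring
  cross : ∀ x → (pos 1 ℤ.+ x) ℤ.* (pos 12 ℤ.* pos 12) ≡ (pos 1 ℤ.* pos 12 ℤ.+ x ℤ.* pos 12) ℤ.* pos 12
  cross = ℤRing.solve-∀
  unnormalised : toℚᵘ ((pos (suc m)) / 12) ℚᵘ.≃ toℚᵘ ((pos 1) / 12 + (pos m) / 12)
  unnormalised = ℚᵘ.≃-trans (ℚ.toℚᵘ-fromℚᵘ (mkℚᵘ (pos (suc m)) 11))
    (ℚᵘ.≃-trans {j = mkℚᵘ (pos 1) 11 ℚᵘ.+ mkℚᵘ (pos m) 11} (*≡* (cross (pos m)))
    (ℚᵘ.≃-sym (ℚᵘ.≃-trans (ℚ.toℚᵘ-homo-+ ((pos 1) / 12) ((pos m) / 12))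
      (ℚᵘ.+-cong (ℚ.toℚᵘ-fromℚᵘ (mkℚᵘ (pos 1) 11)) (ℚ.toℚᵘ-fromℚᵘ (mkℚᵘ (pos m) 11))))))

n≤n^3 : ∀ n → n ℕ.≤ n ℕ.^ 3
n≤n^3 zero = z≤n
n≤n^3 (suc n) = ℕ.m≤m*n (suc n) (suc n ℕ.^ 2) ⦃ ℕ.m^n≢0 (suc n) 2 ⦄

six*2bound : ∀ n → six * (bound n + bound n) ≡ ι n * ι n * ι n - ι n
six*2bound n = begin
  six * (bound n + bound n)
    ≡⟨ cong (λ b → six * (b + b)) (/12≡ι* (n ℕ.^ 3 ℕ.∸ n)) ⟩
  six * (ι (n ℕ.^ 3 ℕ.∸ n) * twelfth + ι (n ℕ.^ 3 ℕ.∸ n) * twelfth)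
    ≡⟨ regroup six twelfth (ι (n ℕ.^ 3 ℕ.∸ n)) ⟩
  (six * (twelfth + twelfth)) * ι (n ℕ.^ 3 ℕ.∸ n)
    -- The closed factor `six * (twelfth + twelfth)` evaluates to `1ℚ`.
    ≡⟨ ℚ.*-identityˡ (ι (n ℕ.^ 3 ℕ.∸ n)) ⟩
  ι (n ℕ.^ 3 ℕ.∸ n)
    ≡⟨ ι-∸ (n≤n^3 n) ⟩
  ι (n ℕ.^ 3) - ι n
    ≡⟨ cong (_- ι n) cube ⟩
  ι n * ι n * ι n - ι n ∎
  where
  open ≡-Reasoning
  twelfth = (pos 1) / 12
  regroup : ∀ s c m → s * (m * c + m * c) ≡ (s * (c + c)) * m
  regroup = solve-∀ ring
  cube : ι (n ℕ.^ 3) ≡ ι n * ι n * ι n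
  cube = trans (ι-* n (n ℕ.^ 2)) (trans (cong (ι n *_)
    (trans (ι-* n (n ℕ.^ 1)) (cong (ι n *_) (trans (ι-* n 1) (ℚ.*-identityʳ (ι n))))))
    (≡-sym (ℚ.*-assoc (ι n) (ι n) (ι n))))

-- Resistances of the n-cycle

module Arc (n : ℕ) (0<n : 0 ℕ.< n) where

  private
    instance
      ιn-positive : Positive (ι n)
      ιn-positive = positive (ι-mono-< 0<n)
      ιn-nonZero = ℚ.pos⇒nonZero (ι n)

  i : ℚ
  i = 1/ ι n

  i*ιn : i * ι n ≡ 1ℚ
  i*ιn = ℚ.*-inverseˡ (ι n)

  0<i : 0ℚ < i
  0<i = ℚ.positive⁻¹ i ⦃ ℚ.1/pos⇒pos (ι n) ⦄

  -- Resistances `k` and `n - k` in parallel, that is, the resistance between two vertices `k` steps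
  -- apart on the `n`-cycle.
  arc : ℕ → ℚ
  arc k = ι k * (ι n - ι k) * i

  -- 6n times the sum of arc over all d < k
  arcSum : ℚ → ℚ
  arcSum k = ι 3 * ι n * k * (k - 1ℚ) - (k - 1ℚ) * k * (k + k - 1ℚ)

  arcSum-step : ∀ k → i * arcSum (ι (suc k)) - i * arcSum (ι k) ≡ six * arc k
  arcSum-step k = poly i (ι n) (ι k)
    where
    poly : ∀ i N k → i * ((1ℚ + (1ℚ + (1ℚ + 0ℚ))) * N * (1ℚ + k) * (1ℚ + k - 1ℚ) - (1ℚ + k - 1ℚ) * (1ℚ + k) *
      (1ℚ + k + (1ℚ + k) - 1ℚ))
      - i * ((1ℚ + (1ℚ + (1ℚ + 0ℚ))) * N * k * (k - 1ℚ) - (k - 1ℚ) * k * (k + k - 1ℚ))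
      ≡ (1ℚ + (1ℚ + (1ℚ + (1ℚ + (1ℚ + (1ℚ + 0ℚ)))))) * (k * (N - k) * i)
    poly = solve-∀ ring

  arcTotal : ℚ
  arcTotal = sumFin n (arc ∘ toℕ)

  six*arcTotal≡arcSum : six * arcTotal ≡ i * arcSum (ι n)
  six*arcTotal≡arcSum = begin
    six * arcTotal
      ≡⟨ sum-* six (arc ∘ toℕ {n}) ⟨
    sumFin n (λ k → six * arc (toℕ k))
      ≡⟨ sum-cong {n} (λ k → arcSum-step (toℕ k)) ⟨
    sumFin n (λ k → i * arcSum (ι (suc (toℕ k))) - i * arcSum (ι (toℕ k)))
      ≡⟨ sum-telescope n (λ k → i * arcSum (ι k)) ⟩
    i * arcSum (ι n) - i * arcSum 0ℚ
      ≡⟨ vanish i (ι n) (i * arcSum (ι n)) ⟩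
    i * arcSum (ι n) ∎
    where
    open ≡-Reasoning
    vanish : ∀ i N x → x - i * ((1ℚ + (1ℚ + (1ℚ + 0ℚ))) * N * 0ℚ * (0ℚ - 1ℚ) - (0ℚ - 1ℚ) * 0ℚ * (0ℚ + 0ℚ - 1ℚ)) ≡ x
    vanish = solve-∀ ring

  -- `n` rows of sum `arcTotal` count every pair twice, so this converts row estimates into the
  -- bound. The factor `six` clears the denominators on both sides.
  n*arcTotal≡2bound : ι n * arcTotal ≡ bound n + bound n
  n*arcTotal≡2bound = *-cancelˡ-pos six 0<six $ begin
    six * (ι n * arcTotal)
      ≡⟨ swap six (ι n) arcTotal ⟩
    ι n * (six * arcTotal)
      ≡⟨ cong (ι n *_) six*arcTotal≡arcSum ⟩
    ι n * (i * arcSum (ι n))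
      ≡⟨ factor i (ι n) ⟩
    (i * ι n) * (ι n * ι n * ι n - ι n)
      ≡⟨ cong (_* (ι n * ι n * ι n - ι n)) i*ιn ⟩
    1ℚ * (ι n * ι n * ι n - ι n)
      ≡⟨ ℚ.*-identityˡ _ ⟩
    ι n * ι n * ι n - ι n
      ≡⟨ six*2bound n ⟨
    six * (bound n + bound n) ∎
    where
    open ≡-Reasoning
    swap : ∀ a b c → a * (b * c) ≡ b * (a * c)
    swap = solve-∀ ring
    factor : ∀ i N → N * (i * ((1ℚ + (1ℚ + (1ℚ + 0ℚ))) * N * N * (N - 1ℚ) - (N - 1ℚ) * N * (N + N - 1ℚ))) ≡
      (i * N) * (N * N * N - N)
    factor = solve-∀ ring

-- Bounds from an st-numbering

-- Forces a chosen edge `wv` to be the first step down from `v` while all ranks stay the same, so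
-- the estimate can exploit any edge that skips ranks.
replaceLower : ∀ {n} {G : Graph n} {s t} (N : STNumbering G s t) v w →
  IsLower G s t (STNumbering.position N) w v → STNumbering G s t
replaceLower {G = G} {s} {t} N v w w-lower = record
  { position = position ; s~t = s~t ; rank-s = rank-s ; rank-t = rank-t
  ; lower = λ x → proj₁ (chosen x) ; higher = higher
  ; lower-is-lower = λ {x} → proj₂ (chosen x) ; higher-is-higher = higher-is-higher }
  where
  open STNumbering N
  chosen : ∀ x → ∃ λ y → x ≢ s → IsLower G s t position y x
  chosen x with x ≟ v
  ... | yes refl = w , λ _ → w-lower
  ... | no _ = lower x , lower-is-lower

module _ {n} {G : Graph n} {s t : Fin n} (0<n : 0 ℕ.< n) where
  open Arc n 0<n

  module _ (N : STNumbering G s t) {v r} (v≢s : v ≢ s) (isR : IsResistance G s v r) where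
    open STNumbering N
    private
      rk = rank G s t position
      -- The current divides in inverse proportion to the lengths `rk v` and `n - rk v`, which
      -- minimises the energy of the test flow.
      α = (ι n - ι (rk v)) * i
      β = ι (rk v) * i

      lower<v : rk (lower v) ℕ.< rk v
      lower<v = proj₁ (proj₂ (lower-is-lower v≢s))

      0<α : 0ℚ < α
      0<α = subst (_< α) (ℚ.*-zeroˡ i) (ℚ.*-monoˡ-<-pos i ⦃ positive 0<i ⦄
        (subst (_< ι n - ι (rk v)) (ℚ.+-inverseʳ (ι (rk v))) (ℚ.+-monoˡ-< (- ι (rk v)) (ι-mono-< (rank<n N v)))))

      split-flow : r ≤ α * α * ι (suc (rk (lower v))) + β * β * (ι n - ι (rk v))
      split-flow = ℚ.≤-trans (ℚ.≤-reflexive (proj₂ (proj₂ isR)))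
        (resistance-bound N (proj₁ isR) v≢s (proj₁ (proj₂ isR)) α β (trans (α+β i (ι n) (ι (rk v))) i*ιn))
        where
        α+β : ∀ i N k → (N - k) * i + k * i ≡ i * N
        α+β = solve-∀ ring

      parallel : α * α * ι (rk v) + β * β * (ι n - ι (rk v)) ≡ arc (rk v)
      parallel = trans (factor i (ι n) (ι (rk v))) (trans (cong (arc (rk v) *_) i*ιn) (ℚ.*-identityʳ (arc (rk v))))
        where
        factor : ∀ i N k → ((N - k) * i) * ((N - k) * i) * k + (k * i) * (k * i) * (N - k) ≡ k * (N - k) * i * (i * N)
        factor = solve-∀ ring

    resistance≤arc : r ≤ arc (rk v)
    resistance≤arc = ℚ.≤-trans split-flow (ℚ.≤-trans (ℚ.+-monoˡ-≤ (β * β * (ι n - ι (rk v)))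
      (ℚ.*-monoˡ-≤-nonNeg (α * α) ⦃ nonNegative (0≤p*p α) ⦄ (ι-mono-≤ lower<v))) (ℚ.≤-reflexive parallel))

    -- The descending route is shorter than `rk v`, and its weight `α * α` is positive since `rk v`
    -- is below `n`.
    resistance<arc : suc (rk (lower v)) ℕ.< rk v → r < arc (rk v)
    resistance<arc gap = ℚ.≤-<-trans split-flow (ℚ.<-≤-trans (ℚ.+-monoˡ-< (β * β * (ι n - ι (rk v)))
      (ℚ.*-monoʳ-<-pos (α * α) ⦃ ℚ.pos*pos⇒pos α ⦃ positive 0<α ⦄ α ⦃ positive 0<α ⦄ ⦄ (ι-mono-< gap)))
        (ℚ.≤-reflexive parallel))

-- The Kirchhoff index as a sum of rows

-- `R` is unconstrained on the diagonal; zeros are put there so that whole rows can be summed.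
offDiagonal : ∀ {n} → (Fin n → Fin n → ℚ) → Fin n → Fin n → ℚ
offDiagonal R u v = if does (u ≟ v) then 0ℚ else R u v

module _ {n} (G : Graph n) (R : Fin n → Fin n → ℚ) (isR : ∀ u v → u ≢ v → IsResistance G u v (R u v)) where

  R-sym : ∀ {u v} → u ≢ v → R u v ≡ R v u
  R-sym {u} {v} u≢v = resistance-sym G (isR u v u≢v) (isR v u (u≢v ∘ ≡-sym))

  Kf+Kf : Kf R + Kf R ≡ sumFin n λ u → sumFin n (offDiagonal R u)
  Kf+Kf = ≡-sym $ begin
    sumFin n (λ u → sumFin n (offDiagonal R u))
      ≡⟨ sum-by-pairs toℕ toℕ-injective (offDiagonal R) (λ u → if-yes (u ≟ u) refl) ⟩
    sum< toℕ (λ u v → offDiagonal R u v + offDiagonal R v u)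
      ≡⟨ sum<-cong toℕ (λ u v u<v → let u≢v = λ { refl → ℕ.<-irrefl refl u<v } in
          cong₂ _+_ (if-no (u ≟ v) u≢v) (trans (if-no (v ≟ u) (u≢v ∘ ≡-sym)) (≡-sym (R-sym u≢v)))) ⟩
    sum< toℕ (λ u v → R u v + R u v)
      ≡⟨ sum-cong (λ u → trans (sum-cong (double u)) (sum-+ (upper u) (upper u))) ⟩
    sumFin n (λ u → sumFin n (upper u) + sumFin n (upper u))
      ≡⟨ sum-+ (λ u → sumFin n (upper u)) (λ u → sumFin n (upper u)) ⟩
    Kf R + Kf R ∎
    where
    open ≡-Reasoning
    upper : Fin n → Fin n → ℚ
    -- This decision computes to `toℕ u ℕ.<ᵇ toℕ v`, so summing `upper` gives `Kf R` by definition.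
    upper u v = if does (toℕ u ℕ.<? toℕ v) then R u v else 0ℚ
    double : ∀ u v → (if does (toℕ u ℕ.<? toℕ v) then R u v + R u v else 0ℚ) ≡ upper u v + upper u v
    double u v with does (toℕ u ℕ.<? toℕ v)
    ... | true = refl
    ... | false = refl

  module _ (0<n : 0 ℕ.< n) {s t : Fin n} (N : STNumbering G s t) where
    open Arc n 0<n
    open STNumbering N
    private
      rk = rank G s t position

      entry : ∀ v → offDiagonal R s v ≤ arc (rk v)
      entry v = by-cases (s ≟ v)
        where
        zero-arc : ∀ i N → 0ℚ ≡ 0ℚ * (N - 0ℚ) * i
        zero-arc = solve-∀ ring
        by-cases : (d : Dec (s ≡ v)) → (if does d then 0ℚ else R s v) ≤ arc (rk v)
        by-cases (no s≢v) = resistance≤arc 0<n N (s≢v ∘ ≡-sym) (isR s v s≢v)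
        by-cases (yes refl) = ℚ.≤-reflexive (trans (zero-arc i (ι n)) (cong arc (≡-sym rank-s)))

      arcs : sumFin n (λ v → arc (rk v)) ≡ arcTotal
      arcs = sum-permute (arc ∘ toℕ) position

    row≤arcTotal : sumFin n (offDiagonal R s) ≤ arcTotal
    row≤arcTotal = subst (sumFin n (offDiagonal R s) ≤_) arcs (sum-mono entry)

    -- Routing the descent from `v` through `w` makes the entry at `v` strict, and the other entries
    -- keep the bound from `N`.
    row<arcTotal : ∀ {v w} → v ≢ s → IsLower G s t position w v → suc (rk w) ℕ.< rk v →
      sumFin n (offDiagonal R s) < arcTotal
    row<arcTotal {v} {w} v≢s w-lower gap = subst (sumFin n (offDiagonal R s) <_) arcs
      (sum-mono-< entry v (subst (_< arc (rk v)) (≡-sym (if-no (s ≟ v) (v≢s ∘ ≡-sym)))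
        (resistance<arc 0<n (replaceLower N v w w-lower) v≢s (isR s v (v≢s ∘ ≡-sym))
          (subst (λ x → suc (rk x) ℕ.< rk v) (≡-sym chosen) gap))))
      where
      chosen : STNumbering.lower (replaceLower N v w w-lower) v ≡ w
      chosen with v ≟ v
      ... | yes refl = refl
      ... | no v≢v = contradiction refl v≢v

  module _ (0<n : 0 ℕ.< n) (number : ∀ s → ∃ (STNumbering G s)) where
    open Arc n 0<n

    Kf≤bound : Kf R ≤ bound n
    Kf≤bound = double-cancel-≤ (begin
      Kf R + Kf R
        ≡⟨ Kf+Kf ⟩
      sumFin n (λ u → sumFin n (offDiagonal R u))
        ≤⟨ sum-mono (λ u → row≤arcTotal 0<n (proj₂ (number u))) ⟩
      sumFin n (λ _ → arcTotal)
        ≡⟨ trans (sum-const n arcTotal) n*arcTotal≡2bound ⟩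
      bound n + bound n ∎)
      where open ℚ.≤-Reasoning

    -- The rows add up to `Kf R + Kf R` and each is at most `arcTotal`, so one strict row would
    -- leave the total below `bound n + bound n`.
    extremal-row≮arcTotal : Kf R ≡ bound n → ∀ u → ¬ (sumFin n (offDiagonal R u) < arcTotal)
    extremal-row≮arcTotal eq u lt = ℚ.<-irrefl (cong₂ _+_ eq eq) (begin-strict
      Kf R + Kf R
        ≡⟨ Kf+Kf ⟩
      sumFin n (λ u → sumFin n (offDiagonal R u))
        <⟨ sum-mono-< (λ u → row≤arcTotal 0<n (proj₂ (number u))) u lt ⟩
      sumFin n (λ _ → arcTotal)
        ≡⟨ trans (sum-const n arcTotal) n*arcTotal≡2bound ⟩
      bound n + bound n ∎)
      where open ℚ.≤-Reasoning

-- Recognising the cycle from a tight st-numbering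

CycleEdge : ℕ → ℕ → ℕ → Set
CycleEdge n a b = b ≡ suc a ⊎ a ≡ suc b ⊎ (a ≡ n ℕ.∸ 1 × b ≡ 0) ⊎ (b ≡ n ℕ.∸ 1 × a ≡ 0)

-- The disjuncts follow the order in `cycleAdj`, so that `does` of this decision is `cycleAdj` by
-- computation.
cycleEdge? : ∀ n a b → Dec (CycleEdge n a b)
cycleEdge? n a b = (b ℕ.≟ suc a) ⊎-dec (a ℕ.≟ suc b) ⊎-dec ((a ℕ.≟ n ℕ.∸ 1) ×-dec (b ℕ.≟ 0)) ⊎-dec
  ((b ℕ.≟ n ℕ.∸ 1) ×-dec (a ℕ.≟ 0))

≡does : ∀ {P : Set} b (d : Dec P) → (b ≡ true → P) → (P → b ≡ true) → b ≡ does d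
≡does true (yes _) _ _ = refl
≡does true (no ¬p) f _ = contradiction (f refl) ¬p
≡does false (yes p) _ g = g p
≡does false (no _) _ _ = refl

module _ {n} {G : Graph n} {s t : Fin n} (N : STNumbering G s t) where
  open STNumbering N
  private
    rk = rank G s t position

  -- Every edge other than `st` raises the rank by exactly one. Conversely `lower x` then has the
  -- rank just below `x`, so consecutive vertices are adjacent. The isomorphism maps a rank to the
  -- vertex holding it, hence `flip position`.
  tight⇒cycle : (∀ {v w} → v ≢ s → IsLower G s t position w v → suc (rk w) ≡ rk v) → IsoToCycle G
  tight⇒cycle tight = flip position , λ i j →
    ≡does (adj G (at i) (at j)) (cycleEdge? n (toℕ i) (toℕ j)) (to i j) (from i j)
    where
    at : Fin n → Fin n
    at i = position ⟨$⟩ˡ i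
    rk-at : ∀ i → rk (at i) ≡ toℕ i
    rk-at i = cong toℕ (inverseʳ position)
    rk-t : rk t ≡ n ℕ.∸ 1
    rk-t = cong (ℕ._∸ 1) rank-t

    upward : ∀ {w x} → adj G w x ≡ true → rk w ℕ.< rk x → suc (rk w) ≡ rk x ⊎ (w ≡ s × x ≡ t)
    upward {w} {x} a lt with (w ≟ s) ×-dec (x ≟ t)
    ... | yes st = inj₂ st
    ... | no ¬st = inj₁ (tight (λ { refl → ℕ.n≮0 (subst (rk w ℕ.<_) rank-s lt) }) (a , lt , ¬st))

    consecutive : ∀ {w x} → suc (rk w) ≡ rk x → adj G w x ≡ true
    consecutive {w} {x} eq = subst (λ y → adj G y x ≡ true)
      (rank-injective N (ℕ.suc-injective (trans (tight x≢s (lower-is-lower x≢s)) (≡-sym eq))))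
        (proj₁ (lower-is-lower x≢s))
      where
      x≢s : x ≢ s
      x≢s refl = ℕ.1+n≢0 (trans eq rank-s)

    to : ∀ i j → adj G (at i) (at j) ≡ true → CycleEdge n (toℕ i) (toℕ j)
    to i j a with ℕ.<-cmp (rk (at i)) (rk (at j))
    ... | tri≈ _ eq _ = contradiction (trans (≡-sym (irrefl G (at i)))
      (subst (λ y → adj G (at i) y ≡ true) (≡-sym (rank-injective N eq)) a)) λ ()
    ... | tri< lt _ _ with upward a lt
    ...   | inj₁ eq = inj₁ (trans (≡-sym (rk-at j)) (trans (≡-sym eq) (cong suc (rk-at i))))
    ...   | inj₂ (i≡s , j≡t) = inj₂ (inj₂ (inj₂ (trans (≡-sym (rk-at j)) (trans (cong rk j≡t) rk-t) , trans
      (≡-sym (rk-at i)) (trans (cong rk i≡s) rank-s))))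
    to i j a | tri> _ _ gt with upward (trans (sym G (at j) (at i)) a) gt
    ...   | inj₁ eq = inj₂ (inj₁ (trans (≡-sym (rk-at i)) (trans (≡-sym eq) (cong suc (rk-at j)))))
    ...   | inj₂ (j≡s , i≡t) = inj₂ (inj₂ (inj₁ (trans (≡-sym (rk-at i)) (trans (cong rk i≡t) rk-t) , trans
      (≡-sym (rk-at j)) (trans (cong rk j≡s) rank-s))))

    at-s : ∀ {i} → toℕ i ≡ 0 → at i ≡ s
    at-s {i} eq = rank-injective N (trans (rk-at i) (trans eq (≡-sym rank-s)))
    at-t : ∀ {i} → toℕ i ≡ n ℕ.∸ 1 → at i ≡ t
    at-t {i} eq = rank-injective N (trans (rk-at i) (trans eq (≡-sym rk-t)))

    from : ∀ i j → CycleEdge n (toℕ i) (toℕ j) → adj G (at i) (at j) ≡ true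
    from i j (inj₁ eq) = consecutive (trans (cong suc (rk-at i)) (trans (≡-sym eq) (≡-sym (rk-at j))))
    from i j (inj₂ (inj₁ eq)) = trans (sym G (at i) (at j))
      (consecutive (trans (cong suc (rk-at j)) (trans (≡-sym eq) (≡-sym (rk-at i)))))
    from i j (inj₂ (inj₂ (inj₁ (it , js)))) = trans (cong₂ (adj G) (at-t it) (at-s js)) (trans (sym G t s) s~t)
    from i j (inj₂ (inj₂ (inj₂ (jt , is)))) = trans (cong₂ (adj G) (at-s is) (at-t jt)) s~t

module _ {n} (G : Graph n) (R : Fin n → Fin n → ℚ) (isR : ∀ u v → u ≢ v → IsResistance G u v (R u v))
  (0<n : 0 ℕ.< n) (number : ∀ s → ∃ (STNumbering G s)) where

  extremal⇒cycle : Kf R ≡ bound n → IsoToCycle G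
  extremal⇒cycle eq = tight⇒cycle N tight
    where
    s = F.fromℕ< 0<n
    N = proj₂ (number s)
    tight : ∀ {v w} → v ≢ s → IsLower G s (proj₁ (number s)) (STNumbering.position N) w v → _
    tight v≢s w-lower@(_ , lt , _) = ℕ.≤-antisym lt (ℕ.≮⇒≥ λ gap →
      extremal-row≮arcTotal G R isR 0<n number eq s (row<arcTotal G R isR 0<n N v≢s w-lower gap))

-- Existence of st-numberings

module _ {n} (G : Graph n) where

  private
    _∈?_ = member? (_≟_ {n})

  Adj : Fin n → Fin n → Set
  Adj x y = adj G x y ≡ true

  Adj-sym : ∀ {x y} → Adj x y → Adj y x
  Adj-sym {x} {y} a = trans (sym G y x) a

  -- In a sublist relation [w, v] ⊆ l the vertex w occurs before v.
  HasBefore HasAfter : List (Fin n) → Fin n → Set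
  HasBefore l v = ∃ λ w → Adj w v × (w ∷ v ∷ []) ⊆ l
  HasAfter l v = ∃ λ w → Adj v w × (v ∷ w ∷ []) ⊆ l

  -- An st-ordering of part of the vertices. That `s` comes first and `t` last is not recorded: it
  -- follows because every other listed vertex has a listed neighbour on either side.
  record Bipolar (s t : Fin n) (l : List (Fin n)) : Set where
    field
      unique : Unique l
      s∈l : s ∈ l
      t∈l : t ∈ l
      before : ∀ {v} → v ∈ l → v ≢ s → HasBefore l v
      after : ∀ {v} → v ∈ l → v ≢ t → HasAfter l v

  -- The interior of an ear: `P` lists distinct vertices outside `l`, starting at `z`, and the last
  -- of them is adjacent to the end `y`, which is not listed.
  data Path (l : List (Fin n)) : Fin n → Fin n → List (Fin n) → Set where
    stop : ∀ {z y} → z ∉ l → Adj z y → Path l z y (z ∷ [])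
    cons : ∀ {z z′ y P} → z ∉ l → Adj z z′ → z ∉ P → Path l z′ y P → Path l z y (z ∷ P)

  suffix : ∀ {l z z′ y P} → z ∈ P → Path l z′ y P → ∃ (Path l z y)
  suffix (here refl) p = _ , path-from-head p
    where
    path-from-head : ∀ {l z z′ y P} → Path l z′ y (z ∷ P) → Path l z y (z ∷ P)
    path-from-head p@(stop _ _) = p
    path-from-head p@(cons _ _ _ _) = p
  suffix (there ()) (stop _ _)
  suffix (there z∈P) (cons _ _ _ p) = suffix z∈P p

  -- The walk is followed until it first enters `l`. If its current vertex recurs on the path
  -- already found, `suffix` cuts the loop. Since the walk avoids `x`, the ear ends at a vertex
  -- other than `x`, the one it is attached to.
  first-hit : ∀ {l x z y₀} → z ∉ l → y₀ ∈ l → Reach G (_≢ x) z y₀ →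
    ∃ λ y → y ∈ l × y ≢ x × ∃ (Path l z y)
  first-hit z∉l y∈l (here _) = contradiction y∈l z∉l
  first-hit {l} z∉l y∈l (step {x = z′} _ a walk) with z′ ∈? l
  ... | yes z′∈l = z′ , z′∈l , start walk , _ , stop z∉l a
    where
    start : ∀ {P u w} → Reach G P u w → P u
    start (here p) = p
    start (step p _ _) = p
  first-hit {l} {z = z} z∉l y∈l (step _ a walk) | no z′∉l with first-hit z′∉l y∈l walk
  ... | y , y∈ , y≢x , P , p with z ∈? P
  ...   | yes z∈P = y , y∈ , y≢x , suffix z∈P p
  ...   | no z∉P = y , y∈ , y≢x , z ∷ P , cons z∉l a z∉P p

  path-unique : ∀ {l z y P} → Path l z y P → Unique P
  path-unique (stop _ _) = [] ∷ []
  path-unique (cons _ _ z∉P p) = ¬Any⇒All¬ _ z∉P ∷ path-unique p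

  path-avoids : ∀ {l z y P v} → Path l z y P → v ∈ P → v ∉ l
  path-avoids (stop z∉l _) (here refl) = z∉l
  path-avoids (cons z∉l _ _ _) (here refl) = z∉l
  path-avoids (cons _ _ _ p) (there v∈P) = path-avoids p v∈P

  path-nonempty : ∀ {l z y P} → Path l z y P → 1 ℕ.≤ length P
  path-nonempty (stop _ _) = s≤s z≤n
  path-nonempty (cons _ _ _ _) = s≤s z≤n

  path-before : ∀ {l x z y P v} → Adj x z → Path l z y P → v ∈ P → HasBefore (x ∷ P ++ [ y ]) v
  path-before a (stop _ _) (here refl) = _ , a , refl ∷ refl ∷ minimum _
  path-before a (cons _ _ _ _) (here refl) = _ , a , refl ∷ refl ∷ minimum _
  path-before a (cons _ a′ _ p) (there v∈P) with path-before a′ p v∈P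
  ... | w , b , sub = w , b , _ ∷ʳ sub

  path-after : ∀ {l x z y P v} → Path l z y P → v ∈ P → HasAfter (x ∷ P ++ [ y ]) v
  path-after (stop _ a) (here refl) = _ , a , _ ∷ʳ refl ∷ refl ∷ []
  path-after (cons _ a _ (stop _ _)) (here refl) = _ , a , _ ∷ʳ refl ∷ refl ∷ minimum _
  path-after (cons _ a _ (cons _ _ _ _)) (here refl) = _ , a , _ ∷ʳ refl ∷ refl ∷ minimum _
  path-after {x = x} (cons _ _ _ p) (there v∈P) with path-after p v∈P
  ... | w , b , sub = w , b , x ∷ʳ sub

  HasBefore-⊆ : ∀ {l l′ v} → l ⊆ l′ → HasBefore l v → HasBefore l′ v
  HasBefore-⊆ sub (w , a , p) = w , a , ⊆-trans p sub

  HasAfter-⊆ : ∀ {l l′ v} → l ⊆ l′ → HasAfter l v → HasAfter l′ v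
  HasAfter-⊆ sub (w , a , p) = w , a , ⊆-trans p sub

  HasBefore-reverse : ∀ {l v} → HasBefore l v → HasAfter (reverse l) v
  HasBefore-reverse (w , a , p) = w , Adj-sym a , Sublist.reverse⁺ p

  HasAfter-reverse : ∀ {l v} → HasAfter l v → HasBefore (reverse l) v
  HasAfter-reverse (w , a , p) = w , Adj-sym a , Sublist.reverse⁺ p

  reverse-ends : ∀ (x : Fin n) P y → reverse (x ∷ P ++ [ y ]) ≡ y ∷ reverse P ++ [ x ]
  reverse-ends x P y = trans (unfold-reverse x (P ++ [ y ])) (cong (_++ [ x ]) (reverse-++ P [ y ]))

  Unique-resp-↭ : ∀ {xs ys : List (Fin n)} → xs ↭ ys → Unique xs → Unique ys
  Unique-resp-↭ p = PermSetoid.Unique-resp-↭ (setoid (Fin n)) (↭⇒↭ₛ p)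

  -- As `y` comes later than `x`, both the old list and `x ∷ Q ++ [ y ]` are sublists of the new
  -- one, and earlier or later neighbours survive in a larger list. `Q` need not be a `Path`, so
  -- that reversed ears are covered too.
  insert : ∀ {s t A x B y Q} → Bipolar s t (A ++ x ∷ B) → y ∈ B → Unique Q → (∀ {v} → v ∈ Q → v ∉ A ++ x ∷ B) →
    (∀ {v} → v ∈ Q → HasBefore (x ∷ Q ++ [ y ]) v × HasAfter (x ∷ Q ++ [ y ]) v) →
    Bipolar s t (A ++ x ∷ Q ++ B)
  insert {s} {t} {A} {x} {B} {y} {Q} bip y∈B uQ avoid local = record
    { unique = Unique-resp-↭ (↭-sym rearranged) (Unique.++⁺ uQ unique λ (v∈Q , v∈l) → avoid v∈Q v∈l)
    ; s∈l = Sublist.lookup l⊆l′ s∈l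
    ; t∈l = Sublist.lookup l⊆l′ t∈l
    ; before = λ v∈l′ v≢s → [ (λ v∈Q → HasBefore-⊆ ear⊆l′ (proj₁ (local v∈Q))) ,
      (λ v∈l → HasBefore-⊆ l⊆l′ (before v∈l v≢s)) ]′ (classify v∈l′)
    ; after = λ v∈l′ v≢t → [ (λ v∈Q → HasAfter-⊆ ear⊆l′ (proj₂ (local v∈Q))) ,
      (λ v∈l → HasAfter-⊆ l⊆l′ (after v∈l v≢t)) ]′ (classify v∈l′)
    }
    where
    open Bipolar bip
    rearranged : A ++ x ∷ Q ++ B ↭ Q ++ A ++ x ∷ B
    rearranged = ↭-trans (Perm.shift x A (Q ++ B))
      (↭-trans (prep x (Perm.shifts A Q)) (↭-trans (↭-sym (Perm.shift x Q (A ++ B)))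
      (Perm.++⁺ˡ Q (↭-sym (Perm.shift x A B)))))
    l⊆l′ : A ++ x ∷ B ⊆ A ++ x ∷ Q ++ B
    l⊆l′ = Sublist.++⁺ (⊆-refl {x = A}) (refl ∷ Sublist.++⁺ˡ Q ⊆-refl)
    ear⊆l′ : x ∷ Q ++ [ y ] ⊆ A ++ x ∷ Q ++ B
    ear⊆l′ = Sublist.++⁺ˡ A (refl ∷ Sublist.++⁺ (⊆-refl {x = Q}) (from∈ y∈B))
    classify : ∀ {v} → v ∈ A ++ x ∷ Q ++ B → v ∈ Q ⊎ v ∈ A ++ x ∷ B
    classify v∈ = ∈-++⁻ Q (Perm.∈-resp-↭ rearranged v∈)

  order : ∀ {x y : Fin n} {l} → x ∈ l → y ∈ l → x ≢ y →
    (∃₂ λ A B → l ≡ A ++ x ∷ B × y ∈ B) ⊎ (∃₂ λ A B → l ≡ A ++ y ∷ B × x ∈ B)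
  order (here refl) (here refl) x≢y = contradiction refl x≢y
  order {l = _ ∷ l} (here refl) (there y∈l) _ = inj₁ ([] , l , refl , y∈l)
  order {l = _ ∷ l} (there x∈l) (here refl) _ = inj₂ ([] , l , refl , x∈l)
  order {l = a ∷ l} (there x∈l) (there y∈l) x≢y with order x∈l y∈l x≢y
  ... | inj₁ (A , B , refl , y∈B) = inj₁ (a ∷ A , B , refl , y∈B)
  ... | inj₂ (A , B , refl , x∈B) = inj₂ (a ∷ A , B , refl , x∈B)

  longer : ∀ A (x : Fin n) Q B → 1 ℕ.≤ length Q → length (A ++ x ∷ B) ℕ.< length (A ++ x ∷ Q ++ B)
  longer [] x Q B 1≤Q rewrite length-++ Q {B} = s≤s (ℕ.+-monoˡ-≤ (length B) 1≤Q)
  longer (_ ∷ A) x Q B 1≤Q = s≤s (longer A x Q B 1≤Q)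

  add-ear : ∀ {s t l x z y P} → Bipolar s t l → x ∈ l → y ∈ l → y ≢ x → Adj x z → Path l z y P →
    ∃ λ l′ → Bipolar s t l′ × length l ℕ.< length l′
  add-ear {x = x} {y = y} {P} bip x∈l y∈l y≢x a p with order x∈l y∈l (≢-sym y≢x)
  ... | inj₁ (A , B , refl , y∈B) = _ ,
    insert bip y∈B (path-unique p) (path-avoids p) (λ v∈P → path-before a p v∈P , path-after p v∈P) ,
    longer A x P B (path-nonempty p)
  -- Here `y` is the earlier end, so the ear goes in backwards, and the roles of `path-before` and
  -- `path-after` are exchanged.
  ... | inj₂ (A , B , refl , x∈B) = _ ,
    insert bip x∈B (Unique-resp-↭ (↭-sym (Perm.↭-reverse P)) (path-unique p)) (λ v∈ → path-avoids p (reverse⁻ v∈))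
      (λ {v} v∈ → subst (λ q → HasBefore q v) (reverse-ends x P y) (HasAfter-reverse (path-after p (reverse⁻ v∈))) ,
              subst (λ q → HasAfter q v) (reverse-ends x P y) (HasBefore-reverse (path-before a p (reverse⁻ v∈)))) ,
    longer A y (reverse P) B (subst (1 ℕ.≤_) (≡-sym (length-reverse P)) (path-nonempty p))

  boundary : ∀ {l x v P} → x ∈ l → v ∉ l → Reach G P x v → ∃₂ λ y z → y ∈ l × z ∉ l × Adj y z
  boundary x∈l v∉l (here _) = contradiction x∈l v∉l
  boundary {l} x∈l v∉l (step {x = z} _ a walk) with z ∈? l
  ... | yes z∈l = boundary z∈l v∉l walk
  ... | no z∉l = _ , z , x∈l , z∉l , a

  lookup-injective : ∀ {l : List (Fin n)} → Unique l → ∀ {i j} → lookup l i ≡ lookup l j → i ≡ j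
  lookup-injective (_ ∷ _) {F.zero} {F.zero} _ = refl
  lookup-injective {_ ∷ l} (x∉ ∷ _) {F.zero} {F.suc j} eq = contradiction eq (All.lookup x∉ (∈-lookup {xs = l} j))
  lookup-injective {_ ∷ l} (x∉ ∷ _) {F.suc i} {F.zero} eq =
    contradiction (≡-sym eq) (All.lookup x∉ (∈-lookup {xs = l} i))
  lookup-injective (_ ∷ u) {F.suc i} {F.suc j} eq = cong F.suc (lookup-injective u eq)

  unique-length : ∀ {l} → Unique l → length l ℕ.≤ n
  unique-length u = injective⇒≤ (lookup-injective u)

  unique-head : ∀ {x : Fin n} {l} → Unique (x ∷ l) → x ∉ l
  unique-head (x∉ ∷ _) = All¬⇒¬Any x∉

  -- Without repetitions each vertex has one occurrence, so order in the sublist sense is order of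
  -- indices, whichever membership proofs are used.
  sublist-index : ∀ {w v : Fin n} {l} → Unique l → (w ∷ v ∷ []) ⊆ l → (p : w ∈ l) (q : v ∈ l) →
    toℕ (index p) ℕ.< toℕ (index q)
  sublist-index u (_ ∷ʳ sub) (here refl) _ = contradiction (Sublist.lookup sub (here refl)) (unique-head u)
  sublist-index u (_ ∷ʳ sub) (there _) (here refl) =
    contradiction (Sublist.lookup sub (there (here refl))) (unique-head u)
  sublist-index (_ ∷ u) (_ ∷ʳ sub) (there p) (there q) = s≤s (sublist-index u sub p q)
  sublist-index u (refl ∷ sub) (here refl) (here refl) = contradiction (to∈ sub) (unique-head u)
  sublist-index u (refl ∷ sub) (here refl) (there q) = s≤s z≤n
  sublist-index u (refl ∷ sub) (there p) _ = contradiction p (unique-head u)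

  neighbour : ∀ {P u w} → u ≢ w → Reach G P u w → ∃ λ x → Adj u x × P x
  neighbour u≢w (here _) = contradiction refl u≢w
  neighbour _ (step _ a (here p)) = _ , a , p
  neighbour _ (step _ a (step p _ _)) = _ , a , p

  Adj⇒≢ : ∀ {x y} → Adj x y → x ≢ y
  Adj⇒≢ {x} a refl = contradiction (trans (≡-sym a) (irrefl G x)) λ ()

third-vertex : ∀ {n} → 3 ℕ.≤ n → (s t : Fin n) → ∃ λ w → w ≢ s × w ≢ t
third-vertex (s≤s (s≤s (s≤s _))) F.zero F.zero = F.suc F.zero , (λ ()) , (λ ())
third-vertex (s≤s (s≤s (s≤s _))) F.zero (F.suc F.zero) = F.suc (F.suc F.zero) , (λ ()) , (λ ())
third-vertex (s≤s (s≤s (s≤s _))) F.zero (F.suc (F.suc _)) = F.suc F.zero , (λ ()) , (λ ())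
third-vertex (s≤s (s≤s (s≤s _))) (F.suc F.zero) F.zero = F.suc (F.suc F.zero) , (λ ()) , (λ ())
third-vertex (s≤s (s≤s (s≤s _))) (F.suc (F.suc _)) F.zero = F.suc F.zero , (λ ()) , (λ ())
third-vertex (s≤s (s≤s (s≤s _))) (F.suc _) (F.suc _) = F.zero , (λ ()) , (λ ())

last-index : ∀ {n} → 0 ℕ.< n → ∃ λ (k : Fin n) → suc (toℕ k) ≡ n
last-index {suc n} _ = F.fromℕ n , cong suc (toℕ-fromℕ n)

module _ {n} (G : Graph n) (two : TwoConnected G) where
  private
    3≤n = proj₁ two
    connected = proj₁ (proj₂ two)
    no-cut = proj₂ (proj₂ two)
    _∈?_ = member? (_≟_ {n})

  -- An edge `yz` leaves the list. Deleting `y` leaves the graph connected, so a walk from `z`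
  -- avoiding `y` reaches whichever of `s` and `t` differs from `y`, and it yields an ear.
  enlarge : ∀ {s t l} → s ≢ t → Bipolar G s t l → ∀ {v} → v ∉ l →
    ∃ λ l′ → Bipolar G s t l′ × length l ℕ.< length l′
  enlarge {s} {t} s≢t bip {v} v∉l =
    let y , z , y∈l , z∉l , a = boundary G s∈l v∉l (connected s v)
        e , e∈l , e≢y = other-end y
        _ , h∈l , h≢y , _ , p = first-hit G z∉l e∈l (no-cut y z e (λ z≡y → z∉l (subst (_∈ _) (≡-sym z≡y) y∈l)) e≢y)
    in add-ear G bip y∈l h∈l h≢y a p
    where
    open Bipolar bip
    other-end : ∀ y → ∃ λ e → e ∈ _ × e ≢ y
    other-end y with s ≟ y
    ... | yes refl = t , t∈l , ≢-sym s≢t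
    ... | no s≢y = s , s∈l , s≢y

  -- Each round adds at least one vertex and spends one unit of `fuel`, so the inequality is
  -- preserved; with no fuel left it would make a repetition-free list longer than `n`.
  exhaust : ∀ fuel {s t l} → s ≢ t → Bipolar G s t l → n ℕ.< length l ℕ.+ fuel →
    ∃ λ l′ → Bipolar G s t l′ × ∀ v → v ∈ l′
  exhaust zero {l = l} _ bip lt = contradiction (unique-length G (Bipolar.unique bip))
    (ℕ.<⇒≱ (subst (n ℕ.<_) (ℕ.+-identityʳ (length l)) lt))
  exhaust (suc fuel) {l = l} s≢t bip lt with all? (_∈? l)
  ... | yes full = l , bip , full
  ... | no ¬full =
    let _ , v∉l = ¬∀⟶∃¬ n (_∈ l) (_∈? l) ¬full
        l′ , bip′ , longer′ = enlarge s≢t bip v∉l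
    in exhaust fuel s≢t bip′ (ℕ.<-≤-trans lt
         (subst (ℕ._≤ length l′ ℕ.+ fuel) (≡-sym (ℕ.+-suc (length l) fuel)) (ℕ.+-monoˡ-≤ fuel longer′)))

  edge-bipolar : ∀ {s t} → Adj G s t → Bipolar G s t (s ∷ t ∷ [])
  edge-bipolar a = record
    { unique = (Adj⇒≢ G a ∷ []) ∷ [] ∷ []
    ; s∈l = here refl
    ; t∈l = there (here refl)
    ; before = λ { (here refl) s≢s → contradiction refl s≢s ; (there (here refl)) _ → _ , a , ⊆-refl }
    ; after = λ { (here refl) _ → _ , a , ⊆-refl ; (there (here refl)) t≢t → contradiction refl t≢t }
    }

  numbering : ∀ {s t l} → Adj G s t → Bipolar G s t l → (∀ v → v ∈ l) → STNumbering G s t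
  numbering {s} {t} {l} a bip full = record
    { position = position
    ; s~t = a
    ; rank-s = rank-s
    ; rank-t = rank-t
    ; lower = λ x → proj₁ (choose-lower x)
    ; higher = λ x → proj₁ (choose-higher x)
    ; lower-is-lower = λ {x} → proj₂ (choose-lower x)
    ; higher-is-higher = λ {x} → proj₂ (choose-higher x)
    }
    where
    open Bipolar bip
    0<n = ℕ.<-≤-trans (s≤s z≤n) 3≤n

    lookup-index-full : ∀ v → lookup l (index (full v)) ≡ v
    lookup-index-full v = ≡-sym (lookup-index (full v))

    length≡n : length l ≡ n
    length≡n = ℕ.≤-antisym (unique-length G unique)
      (injective⇒≤ {f = λ v → index (full v)} (λ {v} {w} → index-injective (setoid (Fin n)) (full v) (full w)))

    to : Fin n → Fin n
    to v = F.cast length≡n (index (full v))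
    from : Fin n → Fin n
    from k = lookup l (F.cast (≡-sym length≡n) k)

    to-from : ∀ k → to (from k) ≡ k
    to-from k = trans (cong (F.cast length≡n) (lookup-injective G unique (lookup-index-full (from k))))
      (cast-involutive length≡n (≡-sym length≡n) k)

    from-to : ∀ v → from (to v) ≡ v
    from-to v = trans (cong (lookup l) (cast-involutive (≡-sym length≡n) length≡n (index (full v))))
      (lookup-index-full v)

    position : Permutation′ n
    position = permutation to from to-from from-to

    rk = rank G s t position

    rk-index : ∀ v → rk v ≡ toℕ (index (full v))
    rk-index v = toℕ-cast length≡n (index (full v))

    ⊆⇒rank< : ∀ {w v} → (w ∷ v ∷ []) ⊆ l → rk w ℕ.< rk v
    ⊆⇒rank< {w} {v} sub rewrite rk-index w | rk-index v = sublist-index G unique sub (full w) (full v)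

    rk-from : ∀ k → rk (from k) ≡ toℕ k
    rk-from k = cong toℕ (to-from k)

    -- If the vertex at position 0 were not `s`, it would have an earlier neighbour. `rank-t` is the
    -- mirror image.
    rank-s : rk s ≡ 0
    rank-s with from (F.fromℕ< 0<n) ≟ s
    ... | yes eq = trans (cong rk (≡-sym eq)) (trans (rk-from _) (toℕ-fromℕ< 0<n))
    ... | no ≢s with before (full _) ≢s
    ...   | w , _ , sub = contradiction (subst (rk w ℕ.<_) (trans (rk-from _) (toℕ-fromℕ< 0<n)) (⊆⇒rank< sub)) ℕ.n≮0

    rank-t : suc (rk t) ≡ n
    rank-t with last-index 0<n
    ... | k , k-last with from k ≟ t
    ...   | yes eq = trans (cong suc (trans (cong rk (≡-sym eq)) (rk-from k))) k-last
    ...   | no ≢t with after (full (from k)) ≢t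
    ...     | w , _ , sub = contradiction (toℕ<n (to w))
                (ℕ.≤⇒≯ (subst (ℕ._≤ rk w) (trans (cong suc (rk-from k)) k-last) (⊆⇒rank< sub)))

    rank<rank-t : ∀ {x} → x ≢ t → rk x ℕ.< rk t
    rank<rank-t {x} x≢t = ℕ.≤∧≢⇒< (ℕ.s≤s⁻¹ (subst (rk x ℕ.<_) (≡-sym rank-t) (toℕ<n (to x))))
      λ eq → x≢t (trans (≡-sym (from-to x)) (trans (cong from (toℕ-injective eq)) (from-to t)))

    choose-lower : ∀ x → ∃ λ w → x ≢ s → IsLower G s t position w x
    choose-lower x with x ≟ s | x ≟ t
    ... | yes refl | _ = s , contradiction refl
    ... | no x≢s | no x≢t = let w , w~x , sub = before (full x) x≢s in
      w , λ _ → w~x , ⊆⇒rank< sub , λ (_ , x≡t) → x≢t x≡t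
    -- The earlier neighbour supplied by the ordering might be `s`, and `st` is reserved. A walk
    -- from `t` to a third vertex that avoids `s` begins with another neighbour, and every vertex
    -- other than `t` ranks below `t`.
    ... | no t≢s | yes refl =
      let e , e≢s , e≢t = third-vertex 3≤n s t
          w , t~w , w≢s = neighbour G (≢-sym e≢t) (no-cut s t e t≢s e≢s)
      in w , λ _ → Adj-sym G t~w , rank<rank-t (≢-sym (Adj⇒≢ G t~w)) , λ (w≡s , _) → w≢s w≡s

    choose-higher : ∀ x → ∃ λ w → x ≢ t → IsHigher G s t position w x
    choose-higher x with x ≟ t
    ... | yes refl = t , contradiction refl
    ... | no x≢t = let w , x~w , sub = after (full x) x≢t in w , λ _ → x~w , ⊆⇒rank< sub

  st-numbering : ∀ s → ∃ (STNumbering G s)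
  st-numbering s =
    let e , e≢s , _ = third-vertex 3≤n s s
        t , a , _ = neighbour G (≢-sym e≢s) (connected s e)
        _ , bip , full = exhaust n (Adj⇒≢ G a) (edge-bipolar a) (ℕ.m≤n⇒m≤1+n ℕ.≤-refl)
    in t , numbering a bip full

-- Explicit potentials on the cycle

module CycleSteps {n} (3≤n : 3 ℕ.≤ n) where

  private
    0<n = ℕ.<-≤-trans (s≤s z≤n) 3≤n

  IsNext IsPrev : Fin n → Fin n → Set
  IsNext w b = toℕ b ≡ suc (toℕ w) ⊎ (suc (toℕ w) ≡ n × toℕ b ≡ 0)
  IsPrev w a = suc (toℕ a) ≡ toℕ w ⊎ (toℕ w ≡ 0 × suc (toℕ a) ≡ n)

  next : ∀ w → ∃ (IsNext w)
  next w with suc (toℕ w) ℕ.<? n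
  ... | yes lt = F.fromℕ< lt , inj₁ (toℕ-fromℕ< lt)
  ... | no ≮n = F.fromℕ< 0<n , inj₂ (ℕ.≤-antisym (toℕ<n w) (ℕ.≮⇒≥ ≮n) , toℕ-fromℕ< 0<n)

  prev : ∀ w → ∃ (IsPrev w)
  prev w with toℕ w in eq
  ... | zero = let k , k-last = last-index 0<n in k , inj₂ (refl , k-last)
  ... | suc m = F.fromℕ< m<n , inj₁ (cong suc (toℕ-fromℕ< m<n))
    where
    m<n : m ℕ.< n
    m<n = ℕ.<-trans (ℕ.n<1+n m) (subst (ℕ._< n) eq (toℕ<n w))

  -- Once a step wraps around, `3≤n` is what keeps the two neighbours apart.
  prev≢next : ∀ {w a b} → IsPrev w a → IsNext w b → a ≢ b
  prev≢next (inj₁ e) (inj₁ f) refl = ℕ.<-irrefl (trans f (cong suc (≡-sym e))) (ℕ.m<n⇒m<1+n (ℕ.n<1+n _))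
  prev≢next (inj₁ e) (inj₂ (g , f)) refl = ℕ.<-irrefl (trans (cong (suc ∘ suc) (≡-sym f)) (trans (cong suc e) g)) 3≤n
  prev≢next (inj₂ (z , e)) (inj₁ f) refl = ℕ.<-irrefl
    (trans (cong (suc ∘ suc) (≡-sym z)) (trans (cong suc (≡-sym f)) e)) 3≤n
  prev≢next (inj₂ (z , e)) (inj₂ (_ , f)) refl = ℕ.<-irrefl (trans (cong suc (≡-sym f)) e)
    (ℕ.<-trans (s≤s (s≤s z≤n)) 3≤n)

  private
    pred-n : suc (n ℕ.∸ 1) ≡ n
    pred-n = ℕ.m+[n∸m]≡n 0<n

  edge⇒step : ∀ {w a b x} → IsPrev w a → IsNext w b → CycleEdge n (toℕ w) (toℕ x) → x ≡ a ⊎ x ≡ b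
  edge⇒step pa (inj₁ f) (inj₁ e) = inj₂ (toℕ-injective (trans e (≡-sym f)))
  edge⇒step {x = x} pa (inj₂ (g , _)) (inj₁ e) = contradiction (toℕ<n x) (ℕ.≤⇒≯ (ℕ.≤-reflexive (≡-sym (trans e g))))
  edge⇒step (inj₁ f) nb (inj₂ (inj₁ e)) = inj₁ (toℕ-injective (ℕ.suc-injective (trans (≡-sym e) (≡-sym f))))
  edge⇒step (inj₂ (z , _)) nb (inj₂ (inj₁ e)) = contradiction (trans (≡-sym e) z) ℕ.1+n≢0
  edge⇒step {b = b} pa (inj₁ f) (inj₂ (inj₂ (inj₁ (e , _)))) = contradiction (toℕ<n b)
    (ℕ.≤⇒≯ (ℕ.≤-reflexive (≡-sym (trans f (trans (cong suc e) pred-n)))))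
  edge⇒step pa (inj₂ (_ , f)) (inj₂ (inj₂ (inj₁ (_ , e)))) = inj₂ (toℕ-injective (trans e (≡-sym f)))
  edge⇒step (inj₁ f) nb (inj₂ (inj₂ (inj₂ (_ , e)))) = contradiction (trans f e) ℕ.1+n≢0
  edge⇒step (inj₂ (_ , f)) nb (inj₂ (inj₂ (inj₂ (e , _)))) =
    inj₁ (toℕ-injective (trans e (ℕ.suc-injective (trans pred-n (≡-sym f)))))

  prev⇒edge : ∀ {w a} → IsPrev w a → CycleEdge n (toℕ w) (toℕ a)
  prev⇒edge (inj₁ e) = inj₂ (inj₁ (≡-sym e))
  prev⇒edge (inj₂ (z , e)) = inj₂ (inj₂ (inj₂ (ℕ.suc-injective (trans e (≡-sym pred-n)) , z)))

  next⇒edge : ∀ {w b} → IsNext w b → CycleEdge n (toℕ w) (toℕ b)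
  next⇒edge (inj₁ e) = inj₁ e
  next⇒edge (inj₂ (g , z)) = inj₂ (inj₂ (inj₁ (ℕ.suc-injective (trans g (≡-sym pred-n)) , z)))

  sum-steps : ∀ {w a b} → IsPrev w a → IsNext w b → (f : Fin n → ℚ) →
    sumFin n (λ x → if cycleAdj n w x then f x else 0ℚ) ≡ f a + f b
  sum-steps {w} {a} {b} pa nb f = begin
    sumFin n (λ x → if cycleAdj n w x then f x else 0ℚ)
      ≡⟨ sum-cong (λ x → pointwise x (cycleEdge? n (toℕ w) (toℕ x)) (x ≟ a) (x ≟ b)) ⟩
    sumFin n (λ x → f x * δ x a + f x * δ x b)
      ≡⟨ sum-+ (λ x → f x * δ x a) (λ x → f x * δ x b) ⟩
    sumFin n (λ x → f x * δ x a) + sumFin n (λ x → f x * δ x b)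
      ≡⟨ cong₂ _+_ (sum-δ f a) (sum-δ f b) ⟩
    f a + f b ∎
    where
    open ≡-Reasoning
    first : ∀ p → p ≡ p * 1ℚ + p * 0ℚ
    first = solve-∀ ring
    second : ∀ p → p ≡ p * 0ℚ + p * 1ℚ
    second = solve-∀ ring
    neither : ∀ p → 0ℚ ≡ p * 0ℚ + p * 0ℚ
    neither = solve-∀ ring
    pointwise : ∀ x (d : Dec (CycleEdge n (toℕ w) (toℕ x))) (da : Dec (x ≡ a)) (db : Dec (x ≡ b)) →
      (if does d then f x else 0ℚ) ≡ f x * (if does da then 1ℚ else 0ℚ) + f x * (if does db then 1ℚ else 0ℚ)
    pointwise x _ (yes refl) (yes refl) = contradiction refl (prev≢next pa nb)
    pointwise x (yes _) (yes _) (no _) = first (f x)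
    pointwise x (yes _) (no _) (yes _) = second (f x)
    pointwise x (yes e) (no x≢a) (no x≢b) with edge⇒step pa nb e
    ... | inj₁ x≡a = contradiction x≡a x≢a
    ... | inj₂ x≡b = contradiction x≡b x≢b
    pointwise x (no _) (no _) (no _) = neither (f x)
    pointwise x (no ¬e) (yes refl) _ = contradiction (prev⇒edge pa) ¬e
    pointwise x (no ¬e) (no _) (yes refl) = contradiction (next⇒edge nb) ¬e

module CycleResistance {n} (3≤n : 3 ℕ.≤ n) where
  private
    0<n = ℕ.<-≤-trans (s≤s z≤n) 3≤n
  open Arc n 0<n
  open CycleSteps 3≤n

  -- Both the resistance between positions `c` and `m` and, as a function of `m`, a potential. The
  -- absolute difference suffices because `arc` takes equal values at `k` and `n - k`.
  distance : ℕ → ℕ → ℚ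
  distance c m = arc ∣ m - c ∣

  cycleLaplacian : (Fin n → ℚ) → Fin n → ℚ
  cycleLaplacian ψ w = sumFin n (λ x → if cycleAdj n w x then ψ w - ψ x else 0ℚ)

  private
    ∣+∣ : ∀ c e → ∣ c ℕ.+ e - c ∣ ≡ e
    ∣+∣ c e = trans (ℕ.m≤n⇒∣n-m∣≡n∸m (ℕ.m≤m+n c e)) (ℕ.m+n∸m≡n c e)

    arc-reflect : ∀ {k} → k ℕ.≤ n → arc (n ℕ.∸ k) ≡ arc k
    arc-reflect {k} k≤n = trans (cong (λ x → x * (ι n - x) * i) (ι-∸ k≤n)) (reflect i (ι n) (ι k))
      where
      reflect : ∀ i N k → (N - k) * (N - (N - k)) * i ≡ k * (N - k) * i
      reflect = solve-∀ ring

    -- `arc` is quadratic with leading coefficient `- i`, so its second difference is constant.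
    arc-curvature : ∀ e → (arc (suc e) - arc e) + (arc (suc e) - arc (suc (suc e))) ≡ i + i
    arc-curvature e = poly i (ι n) (ι e)
      where
      poly : ∀ i N e → ((1ℚ + e) * (N - (1ℚ + e)) * i - e * (N - e) * i) +
        ((1ℚ + e) * (N - (1ℚ + e)) * i - (1ℚ + (1ℚ + e)) * (N - (1ℚ + (1ℚ + e))) * i) ≡ i + i
      poly = solve-∀ ring

    -- At the centre of `distance` both neighbours are one step away. The kink there shifts the
    -- constant curvature by 2, because `i * ι n` is 1.
    arc-peak : (arc 0 - arc 1) + (arc 0 - arc 1) ≡ (i + i) - (1ℚ + 1ℚ)
    arc-peak = trans (poly i (ι n)) (cong (λ u → (i + i) - (u + u)) i*ιn)
      where
      poly : ∀ i N → (0ℚ * (N - 0ℚ) * i - (1ℚ + 0ℚ) * (N - (1ℚ + 0ℚ)) * i) +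
        (0ℚ * (N - 0ℚ) * i - (1ℚ + 0ℚ) * (N - (1ℚ + 0ℚ)) * i)
        ≡ (i + i) - (i * N + i * N)
      poly = solve-∀ ring

    +-swap : ∀ {x : ℚ} a b → a + b ≡ x → b + a ≡ x
    +-swap a b eq = trans (ℚ.+-comm b a) eq

    ∣m-1+m∣ : ∀ m → ∣ m - suc m ∣ ≡ 1
    ∣m-1+m∣ zero = refl
    ∣m-1+m∣ (suc m) = ∣m-1+m∣ m

    curved : ∀ {p q r} e → p ≡ suc e → q ≡ e → r ≡ suc (suc e) → (arc p - arc q) + (arc p - arc r) ≡ i + i
    curved e refl refl refl = arc-curvature e

    peaked : ∀ {p q r} → p ≡ 0 → q ≡ 1 → r ≡ 1 → (arc p - arc q) + (arc p - arc r) ≡ (i + i) - (1ℚ + 1ℚ)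
    peaked refl refl refl = arc-peak

    ∣k+[c+e]-c∣ : ∀ k c e → ∣ k ℕ.+ (c ℕ.+ e) - c ∣ ≡ k ℕ.+ e
    ∣k+[c+e]-c∣ k c e = trans (cong (λ x → ∣ x - c ∣)
      (trans (≡-sym (ℕ.+-assoc k c e)) (trans (cong (ℕ._+ e) (ℕ.+-comm k c)) (ℕ.+-assoc c k e)))) (∣+∣ c (k ℕ.+ e))

    curvature-above : ∀ c e → let m = c ℕ.+ e in
      (distance c (suc m) - distance c m) + (distance c (suc m) - distance c (suc (suc m))) ≡ i + i
    curvature-above c e = curved e (∣k+[c+e]-c∣ 1 c e) (∣+∣ c e) (∣k+[c+e]-c∣ 2 c e)

    curvature-below : ∀ m e → let c = suc (suc m ℕ.+ e) in
      (distance c (suc m) - distance c m) + (distance c (suc m) - distance c (suc (suc m))) ≡ i + i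
    curvature-below m e = +-swap (distance c (suc m) - distance c (suc (suc m))) (distance c (suc m) - distance c m)
      (curved e (trans (ℕ.∣-∣-comm (suc m) c) (∣k+[c+e]-c∣ 1 m e)) (trans (ℕ.∣-∣-comm (suc (suc m)) c) (∣+∣ m e))
        (trans (ℕ.∣-∣-comm m c) (∣k+[c+e]-c∣ 2 m e)))
      where c = suc (suc m ℕ.+ e)

    curvature-off : ∀ c m → c ≢ suc m →
      (distance c (suc m) - distance c m) + (distance c (suc m) - distance c (suc (suc m))) ≡ i + i
    curvature-off c m c≢ = [ above , below ]′ (ℕ.≤-<-connex c m)
      where
      Claim : ℕ → ℕ → Set
      Claim c m = (distance c (suc m) - distance c m) + (distance c (suc m) - distance c (suc (suc m))) ≡ i + i
      above : c ℕ.≤ m → Claim c m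
      above c≤m = let e , eq = ℕ.m≤n⇒∃[o]m+o≡n c≤m in subst (Claim c) eq (curvature-above c e)
      below : m ℕ.< c → Claim c m
      below m<c = let e , eq = ℕ.m≤n⇒∃[o]m+o≡n (ℕ.≤∧≢⇒< m<c (≢-sym c≢)) in subst (λ c → Claim c m) eq
        (curvature-below m e)

    curvature-at : ∀ m →
      (distance (suc m) (suc m) - distance (suc m) m) +
        (distance (suc m) (suc m) - distance (suc m) (suc (suc m))) ≡ (i + i) - (1ℚ + 1ℚ)
    curvature-at m = peaked (ℕ.∣n-n∣≡0 m) (∣m-1+m∣ m) (trans (ℕ.∣-∣-comm (suc m) m) (∣m-1+m∣ m))

    wrap : ∀ {c} → c ℕ.≤ n → distance c 0 ≡ distance c n
    wrap {c} c≤n = trans (≡-sym (arc-reflect c≤n)) (cong arc (≡-sym (ℕ.m≤n⇒∣n-m∣≡n∸m c≤n)))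

  -- Constant curvature everywhere plus a kink at `c`. The constant does not depend on `c`, so it
  -- cancels between two centres.
  distance-laplacian : ∀ c w → cycleLaplacian (distance (toℕ c) ∘ toℕ) w ≡ (i + i) - (δ w c + δ w c)
  distance-laplacian c w = trans (sum-steps pa nb (λ x → h (toℕ w) - h (toℕ x)))
      (trans (cong (λ y → (h (toℕ w) - h (toℕ a)) + (h (toℕ w) - y)) (next-value nb)) (by-cases pa (w ≟ c)))
    where
    a = proj₁ (prev w)
    b = proj₁ (next w)
    pa = proj₂ (prev w)
    nb = proj₂ (next w)
    h = distance (toℕ c)
    next-value : IsNext w b → h (toℕ b) ≡ h (suc (toℕ w))
    next-value (inj₁ e) = cong h e
    -- Position 0 may be read as position `n`, so the successor formula also holds across the wrap.
    next-value (inj₂ (g , z)) = trans (cong h z) (trans (wrap (ℕ.<⇒≤ (toℕ<n c))) (cong h (≡-sym g)))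
    minus-zero : ∀ p → p ≡ p - (0ℚ + 0ℚ)
    minus-zero = solve-∀ ring
    by-cases : IsPrev w a → (d : Dec (w ≡ c)) →
      (h (toℕ w) - h (toℕ a)) + (h (toℕ w) - h (suc (toℕ w))) ≡ (i + i) -
        ((if does d then 1ℚ else 0ℚ) + (if does d then 1ℚ else 0ℚ))
    by-cases (inj₁ e) (yes refl) = subst (λ k → (distance k k - distance k (toℕ a)) +
      (distance k k - distance k (suc k)) ≡ (i + i) - (1ℚ + 1ℚ)) e
      (curvature-at (toℕ a))
    by-cases (inj₁ e) (no w≢c) = trans (subst (λ k → (h k - h (toℕ a)) + (h k - h (suc k)) ≡ i + i) e
      (curvature-off (toℕ c) (toℕ a) (λ eq → w≢c (toℕ-injective (≡-sym (trans eq e)))))) (minus-zero (i + i))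
    by-cases (inj₂ (z , e)) d = trans (cong (λ k → (h k - h (toℕ a)) + (h k - h (suc k))) z) (at-zero (toℕ c) refl d)
      where
      a∸ : toℕ a ≡ n ℕ.∸ 1
      a∸ = cong (ℕ._∸ 1) e
      at-zero : ∀ k → toℕ c ≡ k → (d : Dec (w ≡ c)) →
        (distance k 0 - distance k (toℕ a)) + (distance k 0 - distance k 1) ≡ (i + i) -
          ((if does d then 1ℚ else 0ℚ) + (if does d then 1ℚ else 0ℚ))
      at-zero zero c-eq (yes w≡c) = trans (cong (λ y → (arc 0 - y) + (arc 0 - arc 1)) h-a) arc-peak
        where
        h-a : arc ∣ toℕ a - 0 ∣ ≡ arc 1
        h-a = trans (cong arc (trans (ℕ.∣-∣-identityʳ (toℕ a)) a∸)) (arc-reflect 0<n)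
      at-zero zero c-eq (no w≢c) = contradiction (toℕ-injective (trans z (≡-sym c-eq))) w≢c
      at-zero (suc k) c-eq (yes refl) = contradiction (trans (≡-sym z) c-eq) λ ()
      at-zero (suc k) c-eq (no _) = trans (cong (λ y → (arc (suc k) - y) + (arc (suc k) - arc k)) h-a)
          (trans (+-swap (arc (suc k) - arc k) (arc (suc k) - arc (suc (suc k))) (arc-curvature k))
            (minus-zero (i + i)))
        where
        c<n : suc k ℕ.< n
        c<n = subst (ℕ._< n) c-eq (toℕ<n c)
        -- The predecessor `n - 1` is `n - (k + 2)` away from the centre; reflection turns this into
        -- `k + 2`, completing the three consecutive values for `arc-curvature`.
        h-a : arc ∣ toℕ a - suc k ∣ ≡ arc (suc (suc k))
        h-a = trans (cong arc (trans (cong (λ j → ∣ j - suc k ∣) a∸)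
          (trans (ℕ.m≤n⇒∣n-m∣≡n∸m (ℕ.∸-monoˡ-≤ 1 c<n)) (ℕ.∸-+-assoc n 1 (suc k))))) (arc-reflect c<n)

  -- In the difference of two `distance` potentials only the kinks remain, of size 2 and opposite
  -- sign; `½` scales them to a unit current.
  dipole : Fin n → Fin n → Fin n → ℚ
  dipole a b x = ½ * (distance (toℕ b) (toℕ x) - distance (toℕ a) (toℕ x))

  dipole-laplacian : ∀ a b w → cycleLaplacian (dipole a b) w ≡ δ w a - δ w b
  dipole-laplacian a b w = begin
    cycleLaplacian (dipole a b) w
      ≡⟨ sum-cong (λ x → linear x (cycleAdj n w x)) ⟩
    sumFin n (λ x → ½ * L b x + (- ½) * L a x)
      ≡⟨ sum-+ (λ x → ½ * L b x) (λ x → (- ½) * L a x) ⟩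
    sumFin n (λ x → ½ * L b x) + sumFin n (λ x → (- ½) * L a x)
      ≡⟨ cong₂ _+_ (sum-* ½ (L b)) (sum-* (- ½) (L a)) ⟩
    ½ * sumFin n (L b) + (- ½) * sumFin n (L a)
      ≡⟨ cong₂ (λ x y → ½ * x + (- ½) * y) (distance-laplacian b w) (distance-laplacian a w) ⟩
    ½ * ((i + i) - (δ w b + δ w b)) + (- ½) * ((i + i) - (δ w a + δ w a))
      ≡⟨ collect ½ i (δ w a) (δ w b) ⟩
    (½ + ½) * (δ w a - δ w b)
      ≡⟨ ℚ.*-identityˡ (δ w a - δ w b) ⟩
    δ w a - δ w b ∎
    where
    open ≡-Reasoning
    L : Fin n → Fin n → ℚ
    L c x = if cycleAdj n w x then distance (toℕ c) (toℕ w) - distance (toℕ c) (toℕ x) else 0ℚ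
    expand : ∀ h p q r s → h * (p - q) - h * (r - s) ≡ h * (p - r) + (- h) * (q - s)
    expand = solve-∀ ring
    linear : ∀ x e → (if e then dipole a b w - dipole a b x else 0ℚ) ≡
      ½ * (if e then distance (toℕ b) (toℕ w) - distance (toℕ b) (toℕ x) else 0ℚ) +
      (- ½) * (if e then distance (toℕ a) (toℕ w) - distance (toℕ a) (toℕ x) else 0ℚ)
    linear x true = expand ½ (distance (toℕ b) (toℕ w)) (distance (toℕ a) (toℕ w)) (distance (toℕ b) (toℕ x))
      (distance (toℕ a) (toℕ x))
    linear x false = refl
    collect : ∀ h i a b → h * ((i + i) - (b + b)) + (- h) * ((i + i) - (a + a)) ≡ (h + h) * (a - b)
    collect = solve-∀ ring

  dipole-difference : ∀ a b → dipole a b a - dipole a b b ≡ distance (toℕ a) (toℕ b)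
  dipole-difference a b = begin
    dipole a b a - dipole a b b
      ≡⟨ cong₂ _-_ (cong₂ (λ x y → ½ * (x - y)) (cong arc (ℕ.∣-∣-comm (toℕ a) (toℕ b))) (self a))
        (cong (λ x → ½ * (x - distance (toℕ a) (toℕ b))) (self b)) ⟩
    ½ * (distance (toℕ a) (toℕ b) - 0ℚ) - ½ * (0ℚ - distance (toℕ a) (toℕ b))
      ≡⟨ collect ½ (distance (toℕ a) (toℕ b)) ⟩
    (½ + ½) * distance (toℕ a) (toℕ b)
      ≡⟨ ℚ.*-identityˡ _ ⟩
    distance (toℕ a) (toℕ b) ∎
    where
    open ≡-Reasoning
    zero-arc : ∀ i N → 0ℚ * (N - 0ℚ) * i ≡ 0ℚ
    zero-arc = solve-∀ ring
    self : ∀ c → distance (toℕ c) (toℕ c) ≡ 0ℚ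
    self c = trans (cong arc (ℕ.∣n-n∣≡0 (toℕ c))) (zero-arc i (ι n))
    collect : ∀ h p → h * (p - 0ℚ) - h * (0ℚ - p) ≡ (h + h) * p
    collect = solve-∀ ring

  -- Every row of the cycle has the same sum, shown by telescoping a discrete antiderivative instead
  -- of rotating the cycle.
  distance-row : ∀ c → sumFin n (distance (toℕ c) ∘ toℕ) ≡ arcTotal
  distance-row c = *-cancelˡ-pos six 0<six $ begin
    six * sumFin n (distance (toℕ c) ∘ toℕ)
      ≡⟨ sum-* six (distance (toℕ c) ∘ toℕ {n}) ⟨
    sumFin n (λ k → six * distance (toℕ c) (toℕ k))
      ≡⟨ sum-cong {n} (λ k → telescoping (toℕ c) (toℕ k)) ⟨
    sumFin n (λ k → antiderivative (suc (toℕ k)) - antiderivative (toℕ k))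
      ≡⟨ sum-telescope n antiderivative ⟩
    antiderivative n - antiderivative 0
      ≡⟨ ends ⟩
    i * arcSum (ι n)
      ≡⟨ six*arcTotal≡arcSum ⟨
    six * arcTotal ∎
    where
    open ≡-Reasoning
    P : ℕ → ℚ
    P k = i * arcSum (ι k)
    P0 : P 0 ≡ 0ℚ
    P0 = poly i (ι n)
      where
      poly : ∀ i N → i * ((1ℚ + (1ℚ + (1ℚ + 0ℚ))) * N * 0ℚ * (0ℚ - 1ℚ) - (0ℚ - 1ℚ) * 0ℚ * (0ℚ + 0ℚ - 1ℚ)) ≡ 0ℚ
      poly = solve-∀ ring
    antiderivative : ℕ → ℚ
    -- Truncated subtraction glues the two branches: the first term vanishes up to `c`, the second
    -- beyond `c`. The `suc` is right because `P k` is six times the sum of `arc` over arguments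
    -- strictly below `k`.
    antiderivative k = P (k ℕ.∸ toℕ c) - P (suc (toℕ c) ℕ.∸ k)

    telescoping : ∀ c k → (P (suc k ℕ.∸ c) - P (suc c ℕ.∸ suc k)) - (P (k ℕ.∸ c) - P (suc c ℕ.∸ k))
      ≡ six * distance c k
    telescoping zero zero = trans (shuffle (P 1) (P 0))
      (trans (cong₂ _+_ (arcSum-step 0) (arcSum-step 0)) (poly i (ι n)))
      where
      shuffle : ∀ a b → (a - b) - (b - a) ≡ (a - b) + (a - b)
      shuffle = solve-∀ ring
      poly : ∀ i N → (1ℚ + (1ℚ + (1ℚ + (1ℚ + (1ℚ + (1ℚ + 0ℚ)))))) * (0ℚ * (N - 0ℚ) * i) +
        (1ℚ + (1ℚ + (1ℚ + (1ℚ + (1ℚ + (1ℚ + 0ℚ)))))) * (0ℚ * (N - 0ℚ) * i)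
        ≡ (1ℚ + (1ℚ + (1ℚ + (1ℚ + (1ℚ + (1ℚ + 0ℚ)))))) * (0ℚ * (N - 0ℚ) * i)
      poly = solve-∀ ring
    telescoping zero (suc k) = trans (cong (λ x → (P (suc (suc k)) - P 0) - (P (suc k) - P x)) (ℕ.0∸n≡0 k))
      (trans (shuffle (P (suc (suc k))) (P 0) (P (suc k))) (arcSum-step (suc k)))
      where
      shuffle : ∀ a b c → (a - b) - (c - b) ≡ a - c
      shuffle = solve-∀ ring
    telescoping (suc c) zero = trans (cong (λ x → (P x - P (suc c)) - (P 0 - P (suc (suc c)))) (ℕ.0∸n≡0 c))
      (trans (shuffle (P 0) (P (suc c)) (P (suc (suc c)))) (arcSum-step (suc c)))
      where
      shuffle : ∀ a b c → (a - b) - (a - c) ≡ c - b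
      shuffle = solve-∀ ring
    telescoping (suc c) (suc k) = telescoping c k

    -- What remains is `P (n - c) + P (1 + c)`, the distances on the two sides of `c`; `poly` shows
    -- that it does not depend on `c`.
    ends : antiderivative n - antiderivative 0 ≡ i * arcSum (ι n)
    ends = trans (cong₂ (λ x y → (P (n ℕ.∸ toℕ c) - x) - (y - P (suc (toℕ c))))
        (trans (cong P (ℕ.m≤n⇒m∸n≡0 (toℕ<n c))) P0) (trans (cong P (ℕ.0∸n≡0 (toℕ c))) P0))
      (trans (cong (λ x → (i * arcSum x - 0ℚ) - (0ℚ - P (suc (toℕ c)))) (ι-∸ (ℕ.<⇒≤ (toℕ<n c))))
        (poly i (ι n) (ι (toℕ c))))
      where
      poly : ∀ i N c → (i * ((1ℚ + (1ℚ + (1ℚ + 0ℚ))) * N * (N - c) * ((N - c) - 1ℚ) - ((N - c) - 1ℚ) * (N - c) *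
        ((N - c) + (N - c) - 1ℚ)) - 0ℚ)
        - (0ℚ - i * ((1ℚ + (1ℚ + (1ℚ + 0ℚ))) * N * (1ℚ + c) * ((1ℚ + c) - 1ℚ) - ((1ℚ + c) - 1ℚ) * (1ℚ + c) *
          ((1ℚ + c) + (1ℚ + c) - 1ℚ)))
        ≡ i * ((1ℚ + (1ℚ + (1ℚ + 0ℚ))) * N * N * (N - 1ℚ) - (N - 1ℚ) * N * (N + N - 1ℚ))
      poly = solve-∀ ring

  module _ (G : Graph n) (R : Fin n → Fin n → ℚ) (isR : ∀ u v → u ≢ v → IsResistance G u v (R u v)) where

    cycle⇒extremal : IsoToCycle G → Kf R ≡ bound n
    cycle⇒extremal (π , iso) = double-injective $ begin
      Kf R + Kf R
        ≡⟨ Kf+Kf G R isR ⟩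
      sumFin n (λ u → sumFin n (offDiagonal R u))
        ≡⟨ sum-permute (λ u → sumFin n (offDiagonal R u)) π ⟨
      sumFin n (λ a → sumFin n (offDiagonal R (π ⟨$⟩ʳ a)))
        ≡⟨ sum-cong (λ a → ≡-sym (sum-permute (offDiagonal R (π ⟨$⟩ʳ a)) π)) ⟩
      sumFin n (λ a → sumFin n (λ b → offDiagonal R (π ⟨$⟩ʳ a) (π ⟨$⟩ʳ b)))
        ≡⟨ sum-cong (λ a → trans (sum-cong (entry a)) (distance-row a)) ⟩
      sumFin n (λ _ → arcTotal)
        ≡⟨ trans (sum-const n arcTotal) n*arcTotal≡2bound ⟩
      bound n + bound n ∎
      where
      open ≡-Reasoning
      transport : (Fin n → ℚ) → Fin n → ℚ
      transport ψ v = ψ (π ⟨$⟩ˡ v)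

      transport-laplacian : ∀ ψ a → laplacian G (transport ψ) (π ⟨$⟩ʳ a) ≡ cycleLaplacian ψ a
      transport-laplacian ψ a = trans
        (≡-sym (sum-permute (λ x → if adj G (π ⟨$⟩ʳ a) x then transport ψ (π ⟨$⟩ʳ a) - transport ψ x else 0ℚ) π))
        (sum-cong λ x → cong₂ (λ e q → if e then q else 0ℚ) (iso a x)
          (cong₂ (λ p q → ψ p - ψ q) (inverseˡ π) (inverseˡ π)))

      δ-π : ∀ {a b} → δ (π ⟨$⟩ʳ a) (π ⟨$⟩ʳ b) ≡ δ a b
      δ-π {a} {b} = by-cases (a ≟ b)
        where
        by-cases : (d : Dec (a ≡ b)) → δ (π ⟨$⟩ʳ a) (π ⟨$⟩ʳ b) ≡ (if does d then 1ℚ else 0ℚ)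
        by-cases (yes refl) = δ-refl (π ⟨$⟩ʳ a)
        by-cases (no a≢b) = δ-≢ λ eq → a≢b (π-injective eq)
          where
          π-injective : ∀ {a b} → π ⟨$⟩ʳ a ≡ π ⟨$⟩ʳ b → a ≡ b
          π-injective eq = trans (≡-sym (inverseˡ π)) (trans (cong (π ⟨$⟩ˡ_) eq) (inverseˡ π))

      -- The dipole potential of the standard cycle is pulled back along the inverse of `π`; by
      -- uniqueness this determines the entries of `R` off the diagonal.
      cycle-resistance : ∀ a b → IsResistance G (π ⟨$⟩ʳ a) (π ⟨$⟩ʳ b) (distance (toℕ a) (toℕ b))
      cycle-resistance a b = transport (dipole a b) , equation ,
        trans (≡-sym (dipole-difference a b)) (cong₂ (λ p q → dipole a b p - dipole a b q) (≡-sym (inverseˡ π))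
          (≡-sym (inverseˡ π)))
        where
        equation : ∀ w → laplacian G (transport (dipole a b)) w ≡ δ w (π ⟨$⟩ʳ a) - δ w (π ⟨$⟩ʳ b)
        equation w = subst (λ w → laplacian G (transport (dipole a b)) w ≡ δ w (π ⟨$⟩ʳ a) - δ w (π ⟨$⟩ʳ b))
          (inverseʳ π)
          (trans (transport-laplacian (dipole a b) (π ⟨$⟩ˡ w))
            (trans (dipole-laplacian a b (π ⟨$⟩ˡ w)) (≡-sym (cong₂ _-_ δ-π δ-π))))

      entry : ∀ a b → offDiagonal R (π ⟨$⟩ʳ a) (π ⟨$⟩ʳ b) ≡ distance (toℕ a) (toℕ b)
      entry a b = by-cases ((π ⟨$⟩ʳ a) ≟ (π ⟨$⟩ʳ b))
        where
        by-cases : (d : Dec (π ⟨$⟩ʳ a ≡ π ⟨$⟩ʳ b)) →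
          (if does d then 0ℚ else R (π ⟨$⟩ʳ a) (π ⟨$⟩ʳ b)) ≡ distance (toℕ a) (toℕ b)
        by-cases (no a≢b) = resistance-unique G (isR _ _ a≢b) (cycle-resistance a b)
        -- On the diagonal nothing is known of `R`; the distance is zero because it is a potential
        -- difference between equal vertices.
        by-cases (yes eq) = ≡-sym (trans (proj₂ (proj₂ (cycle-resistance a b)))
          (trans (cong (λ v → transport (dipole a b) (π ⟨$⟩ʳ a) - transport (dipole a b) v) (≡-sym eq))
            (ℚ.+-inverseʳ (transport (dipole a b) (π ⟨$⟩ʳ a)))))

theorem2p9 : (n : ℕ) (G : Graph n) → TwoConnected G →
    (R : Fin n → Fin n → ℚ) → (∀ u v → u ≢ v → IsResistance G u v (R u v)) →
    (Kf R ≤ bound n) × ((Kf R ≡ bound n) ⇔ IsoToCycle G)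
theorem2p9 n G two@(3≤n , _) R isR =
  Kf≤bound G R isR 0<n (st-numbering G two) ,
  mk⇔ (extremal⇒cycle G R isR 0<n (st-numbering G two)) (CycleResistance.cycle⇒extremal 3≤n G R isR)
  where
  0<n = ℕ.<-≤-trans (s≤s z≤n) 3≤n
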